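{- For any integer $g\ge 3$ and any odd prime power $p\equiv 1\pmod 4$, there exists a $\frac{p+1}{2}$-regular oriented graph $D$ with directed girth at least $g$ such that ${\rm fas}(D)\ge \frac{p+1-2\sqrt p}{4(p+1)}\,a(D)$, and therefore ${\rm fasd}(D)\le \frac{4(p+1)}{p+1-2\sqrt p}$.
   Context: An oriented graph is a digraph without loops, multiple arcs or directed $2$-cycles. A digraph is $k$-regular if every vertex has in-degree and out-degree exactly $k$. Directed girth = minimum length of a directed cycle. ${\rm fas}(D)$ is the minimum size of a feedback arc set (set of arcs whose removal makes $D$ acyclic); $a(D)=|A(D)|$; ${\rm fasd}(D)$ is the maximum number $t$ such that $A(D)$ can be partitioned into $t$ feedback arc sets. -}

module Defs where

open import Data.Nat using (ℕ; zero; suc; _+_; _*_; _∸_; _≤_; _<_; _^_)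
open import Data.Nat.Primality using (Prime)
open import Data.Bool using (Bool; true; false; if_then_else_; _∧_)
open import Data.Fin using (Fin; zero; suc; inject₁; fromℕ; _≟_)
open import Data.Product using (Σ; _×_; _,_)
open import Data.Sum using (_⊎_)
open import Relation.Binary.PropositionalEquality using (_≡_)
open import Relation.Nullary using (¬_)
open import Relation.Nullary.Decidable using (⌊_⌋)
open import Function.Definitions using (Injective)

Digraph : ℕ → Set
Digraph n = Fin n → Fin n → Bool

sumFin : ∀ {n} → (Fin n → ℕ) → ℕ
sumFin {zero}  f = 0
sumFin {suc n} f = f zero + sumFin (λ i → f (suc i))

count : ∀ {n} → (Fin n → Bool) → ℕ
count f = sumFin (λ i → if f i then 1 else 0)

outDeg : ∀ {n} → Digraph n → Fin n → ℕ
outDeg A u = count (λ v → A u v)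

inDeg : ∀ {n} → Digraph n → Fin n → ℕ
inDeg A v = count (λ u → A u v)

arcCount : ∀ {n} → Digraph n → ℕ
arcCount A = sumFin (λ u → outDeg A u)

Oriented : ∀ {n} → Digraph n → Set
Oriented A = (∀ u → A u u ≡ false) × (∀ u v → A u v ≡ true → A v u ≡ false)

Regular : ∀ {n} → ℕ → Digraph n → Set
Regular k A = ∀ u → (outDeg A u ≡ k) × (inDeg A u ≡ k)

record DirCycle {n} (A : Digraph n) (len : ℕ) : Set where
  field
    k      : ℕ
    len≡   : len ≡ suc k
    v      : Fin (suc k) → Fin n
    inj    : Injective _≡_ _≡_ v
    step   : ∀ (i : Fin k) → A (v (inject₁ i)) (v (suc i)) ≡ true
    close  : A (v (fromℕ k)) (v zero) ≡ true

GirthAtLeast : ∀ {n} → ℕ → Digraph n → Set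
GirthAtLeast g A = ∀ len → len < g → ¬ DirCycle A len

Acyclic : ∀ {n} → Digraph n → Set
Acyclic A = ∀ len → ¬ DirCycle A len

_minus_ : ∀ {n} → Digraph n → Digraph n → Digraph n
(A minus F) u v = if F u v then false else A u v

IsFAS : ∀ {n} → Digraph n → Digraph n → Set
IsFAS A F = (∀ u v → F u v ≡ true → A u v ≡ true) × Acyclic (A minus F)

-- x ≤ y + 2·√p·a   (over the reals), expressed in ℕ without square roots:
-- either x ≤ y, or (x - y)² ≤ 4·p·a².
LeWithSqrt : (x y p a : ℕ) → Set
LeWithSqrt x y p a = x ≤ y ⊎ (x ∸ y) * (x ∸ y) ≤ 4 * p * (a * a)

-- fas(D) ≥ (p+1-2√p)/(4(p+1)) · a(D):
-- every feedback arc set F satisfies 4(p+1)|F| ≥ (p+1-2√p)·a(D),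
-- i.e. (p+1)·a(D) ≤ 4(p+1)|F| + 2√p·a(D).
FasLowerBound : ∀ {n} → ℕ → Digraph n → Set
FasLowerBound p A =
  ∀ F → IsFAS A F →
    LeWithSqrt ((suc p) * arcCount A) (4 * suc p * arcCount F) p (arcCount A)

colourClass : ∀ {n t} → Digraph n → (Fin n → Fin n → Fin t) → Fin t → Digraph n
colourClass A c j u v = A u v ∧ ⌊ c u v ≟ j ⌋

FASPartition : ∀ {n} → Digraph n → ℕ → Set
FASPartition {n} A t =
  Σ (Fin n → Fin n → Fin t) λ c → ∀ j → IsFAS A (colourClass A c j)

-- fasd(D) ≤ 4(p+1)/(p+1-2√p): every t such that A(D) can be partitioned
-- into t feedback arc sets satisfies t(p+1-2√p) ≤ 4(p+1),
-- i.e. t(p+1) ≤ 4(p+1) + 2√p·t.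
FasdUpperBound : ∀ {n} → ℕ → Digraph n → Set
FasdUpperBound p A =
  ∀ t → FASPartition A t → LeWithSqrt (t * suc p) (4 * suc p) p t

OddPrimePower : ℕ → Set
OddPrimePower q = Σ ℕ λ r → Σ ℕ λ m → Prime r × 1 ≤ m × q ≡ r ^ m × ¬ (2 ≡ r)

{-# OPTIONS --safe #-}
module Submission where

open import Defs
open import Data.Nat using (ℕ; zero; suc; pred; _+_; _*_; _∸_; _^_; _!; _≤_; _<_; _≡ᵇ_; _≤ᵇ_; _<ᵇ_; _≤′_; ≤′-refl; ≤′-step; _≤?_; _<?_; z≤n; s≤s; s≤s⁻¹; >-nonZero; nonTrivial⇒n>1)
open import Data.Nat.Properties hiding (_≟_)
open import Data.Nat.DivMod using (_/_; _%_; m≡m%n+[m/n]*n; m*n/n≡m)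
open import Data.Nat.Primality using (prime⇒nonTrivial)
open import Data.Nat.Tactic.RingSolver using (solve-∀)
open import Data.Bool using (Bool; T; true; false; if_then_else_; not; _∧_; _xor_)
import Data.Bool.Properties as Bool
open import Data.Fin using (Fin; zero; suc; toℕ; fromℕ; fromℕ<; inject₁; splitAt; _↑ˡ_; _↑ʳ_; combine; remQuot; finToFun; funToFin; _≟_)
import Data.Fin.Properties as Fin
open import Data.Product using (Σ; ∃-syntax; ∃₂; _×_; _,_; proj₁; proj₂)
open import Data.Sum using (_⊎_; inj₁; inj₂; [_,_]′)
open import Data.Empty using (⊥; ⊥-elim)
open import Data.Unit using (tt)
open import Function using (_∘_; case_of_)
open import Relation.Nullary using (¬_; yes; no; contradiction)
open import Relation.Nullary.Decidable using (⌊_⌋; _×-dec_; _→-dec_)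
open import Relation.Binary.PropositionalEquality using (_≡_; _≢_; refl; sym; trans; cong; cong₂; subst; subst₂; module ≡-Reasoning)

-- Put k = (p + 1) / 2.  In a k-regular oriented graph every vertex set S is left by as many arcs as enter
-- it, and a feedback arc set contains all arcs leaving some S with half of the vertices.  So it suffices
-- that all balanced cuts are large, and a first moment estimate provides this: arcs are added greedily,
-- the head of each chosen so that no closed walk shorter than g arises and so that a potential, the sum
-- over balanced S of a bound for the expected exponential weight of the cut, grows by little more than
-- the factor of the average choice.  Only boundedly many heads are obstructed at any time, so this works
-- until boundedly many arcs are missing and costs only a polynomial factor.  The gain is exponential even
-- for cuts prescribed by a suitable rational a / b < √(2k − 1) = √p in place of √p.  Each missing arc u → v
-- is finally replaced by a detour through a fresh blow-up of a directed g-cycle from which one arc has been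
-- removed; the strict inequality a / b < √p absorbs these boundedly many additional vertices.

-- Finite sums

-- The threshold √p is within reach of a first moment argument because of a gap between two
-- exponents. On n vertices the at most 2 ^ n balanced sets contribute ln 2 ≈ 0.69 per vertex. For a
-- fixed balanced set and a random matching of tails with heads, the cut behaves, up to a polynomial
-- factor, like the number of successes in kn fair coin tosses, so it falls below the proportion (1
-- - x) / 2 of the arcs with probability at most about exp(-k n x² / 2). At x = √p / k this exponent
-- is (2k - 1) / (2k) per vertex, at least 5 / 6 for k ≥ 3. The surplus allows x to be lowered to a
-- rational a / (b k). The greedy choice of heads is the method of conditional expectations for this
-- estimate, which lets the girth condition be respected at every step. The weights c and d are
-- those of the exponential Markov inequality; cleared of denominators and logarithms, the whole
-- estimate becomes one comparison of natural numbers, `decay`.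

sum-cong : ∀ {n} {f g : Fin n → ℕ} → (∀ i → f i ≡ g i) → sumFin f ≡ sumFin g
sum-cong {zero}  h = refl
sum-cong {suc n} h = cong₂ _+_ (h zero) (sum-cong (h ∘ suc))

sum-mono : ∀ {n} {f g : Fin n → ℕ} → (∀ i → f i ≤ g i) → sumFin f ≤ sumFin g
sum-mono {zero}  h = z≤n
sum-mono {suc n} h = +-mono-≤ (h zero) (sum-mono (h ∘ suc))

sum-+ : ∀ {n} (f g : Fin n → ℕ) → sumFin (λ i → f i + g i) ≡ sumFin f + sumFin g
sum-+ {zero}  f g = refl
sum-+ {suc n} f g rewrite sum-+ (f ∘ suc) (g ∘ suc) = +-interchange (f zero) (g zero) _ _
  where
  +-interchange : ∀ a b c d → (a + b) + (c + d) ≡ (a + c) + (b + d)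
  +-interchange = solve-∀

sum-*ˡ : ∀ {n} c (f : Fin n → ℕ) → sumFin (λ i → c * f i) ≡ c * sumFin f
sum-*ˡ {zero}  c f = sym (*-zeroʳ c)
sum-*ˡ {suc n} c f rewrite sum-*ˡ c (f ∘ suc) = sym (*-distribˡ-+ c (f zero) _)

sum-*ʳ : ∀ {n} (f : Fin n → ℕ) c → sumFin (λ i → f i * c) ≡ sumFin f * c
sum-*ʳ f c = trans (sum-cong (λ i → *-comm (f i) c)) (trans (sum-*ˡ c f) (*-comm c _))

sum-const : ∀ n c → sumFin {n} (λ _ → c) ≡ n * c
sum-const zero    c = refl
sum-const (suc n) c = cong (c +_) (sum-const n c)

sum-zero : ∀ n → sumFin {n} (λ _ → 0) ≡ 0
sum-zero n = trans (sum-const n 0) (*-zeroʳ n)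

sum-swap : ∀ {m n} (f : Fin m → Fin n → ℕ) →
  sumFin (λ i → sumFin (f i)) ≡ sumFin (λ j → sumFin (λ i → f i j))
sum-swap {zero}  {n} f = sym (sum-zero n)
sum-swap {suc m} {n} f rewrite sum-swap (f ∘ suc) = sym (sum-+ (f zero) _)

term≤sum : ∀ {n} (f : Fin n → ℕ) i → f i ≤ sumFin f
term≤sum f zero    = m≤m+n _ _
term≤sum f (suc i) = ≤-trans (term≤sum (f ∘ suc) i) (m≤n+m _ _)

sum≡0 : ∀ {n} (f : Fin n → ℕ) → sumFin f ≡ 0 → ∀ i → f i ≡ 0
sum≡0 f h i = n≤0⇒n≡0 (≤-trans (term≤sum f i) (≤-reflexive h))

sum-join : ∀ m {n} (f : Fin (m + n) → ℕ) →
  sumFin f ≡ sumFin (λ i → f (i ↑ˡ n)) + sumFin (λ j → f (m ↑ʳ j))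
sum-join zero    f = refl
sum-join (suc m) f rewrite sum-join m (f ∘ suc) = sym (+-assoc (f zero) _ _)

sum-combine : ∀ m {n} (f : Fin (m * n) → ℕ) →
  sumFin f ≡ sumFin (λ i → sumFin (λ j → f (combine {m} {n} i j)))
sum-combine zero        f = refl
sum-combine (suc m) {n} f =
  trans (sum-join n f) (cong (sumFin (λ j → f (j ↑ˡ m * n)) +_) (sum-combine m (λ j → f (n ↑ʳ j))))

𝟙 : Bool → ℕ
𝟙 b = if b then 1 else 0

𝟙≤1 : ∀ b → 𝟙 b ≤ 1
𝟙≤1 true  = ≤-refl
𝟙≤1 false = z≤n

δ : ∀ {n} → Fin n → Fin n → ℕ
δ i j = 𝟙 ⌊ i ≟ j ⌋

δ-refl : ∀ {n} (i : Fin n) → δ i i ≡ 1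
δ-refl i with i ≟ i
... | yes _  = refl
... | no i≢i = contradiction refl i≢i

δ-suc : ∀ {n} (i j : Fin n) → δ (suc i) (suc j) ≡ δ i j
δ-suc i j with i ≟ j
... | yes _ = refl
... | no _  = refl

sum-δ : ∀ {n} (f : Fin n → ℕ) j → sumFin (λ i → δ i j * f i) ≡ f j
sum-δ {suc n} f zero    = trans (cong₂ _+_ (+-identityʳ (f zero)) (sum-zero n)) (+-identityʳ _)
sum-δ {suc n} f (suc j) =
  trans (sum-cong (λ i → cong (_* f (suc i)) (δ-suc i j))) (sum-δ (f ∘ suc) j)

sum-δ₁ : ∀ {n} (j : Fin n) → sumFin (λ i → δ i j) ≡ 1
sum-δ₁ j = trans (sum-cong (λ i → sym (*-identityʳ (δ i j)))) (sum-δ (λ _ → 1) j)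

-- Weighted averaging. The conclusion keeps `0 < w v` because the weight will be supported on the
-- admissible heads, and the head chosen must be one of them.
∃-below-average : ∀ {n} (w q : Fin n → ℕ) → 0 < sumFin w →
  ∃[ v ] 0 < w v × sumFin w * q v ≤ sumFin (λ i → w i * q i)
∃-below-average {suc n} w q pos with w zero in w₀ | sumFin (w ∘ suc) in ws
... | zero  | s = let (v , p , h) = ∃-below-average (w ∘ suc) (q ∘ suc) (subst (0 <_) (sym ws) pos)
                  in suc v , p , subst (λ s → s * q (suc v) ≤ _) ws h
... | suc a | zero  = zero , subst (0 <_) (sym w₀) (s≤s z≤n) ,
  ≤-trans (≤-reflexive (cong (_* q zero) (+-identityʳ (suc a)))) (m≤m+n _ _)
... | suc a | suc b
  with ∃-below-average (w ∘ suc) (q ∘ suc) (subst (0 <_) (sym ws) (s≤s z≤n))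
... | v , p , h with q zero ≤? q (suc v)
...   | yes q₀≤ = zero , subst (0 <_) (sym w₀) (s≤s z≤n) , (begin
  (suc a + suc b) * q zero                   ≡⟨ *-distribʳ-+ (q zero) (suc a) (suc b) ⟩
  suc a * q zero + suc b * q zero            ≤⟨ +-monoʳ-≤ (suc a * q zero) (*-monoʳ-≤ (suc b) q₀≤) ⟩
  suc a * q zero + suc b * q (suc v)         ≡⟨ cong (λ s → suc a * q zero + s * q (suc v)) ws ⟨
  suc a * q zero + sumFin (w ∘ suc) * q (suc v) ≤⟨ +-monoʳ-≤ (suc a * q zero) h ⟩
  suc a * q zero + sumFin (λ i → w (suc i) * q (suc i)) ∎)
  where open ≤-Reasoning
...   | no q₀≰ = suc v , p , (begin
  (suc a + suc b) * q (suc v)                ≡⟨ *-distribʳ-+ (q (suc v)) (suc a) (suc b) ⟩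
  suc a * q (suc v) + suc b * q (suc v)      ≤⟨ +-monoˡ-≤ _ (*-monoʳ-≤ (suc a) (<⇒≤ (≰⇒> q₀≰))) ⟩
  suc a * q zero + suc b * q (suc v)         ≡⟨ cong (λ s → suc a * q zero + s * q (suc v)) ws ⟨
  suc a * q zero + sumFin (w ∘ suc) * q (suc v) ≤⟨ +-monoʳ-≤ (suc a * q zero) h ⟩
  suc a * q zero + sumFin (λ i → w (suc i) * q (suc i)) ∎)
  where open ≤-Reasoning

∃-below-constant : ∀ {n} k (f : Fin n → ℕ) → sumFin f < k * n → ∃[ v ] f v < k
∃-below-constant {n} k f h with Fin.any? (λ v → f v <? k)
... | yes e = e
... | no ¬e = contradiction h (≤⇒≯ (≤-trans
  (≤-reflexive (trans (*-comm k n) (sym (sum-const n k))))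
  (sum-mono (λ v → ≮⇒≥ (λ f<k → ¬e (v , f<k))))))

-- Digraphs with arcs added one at a time

total : ∀ {n} → (Fin n → Fin n → ℕ) → Digraph n → ℕ
total f A = sumFin λ a → sumFin λ b → 𝟙 (A a b) * f a b

-- An identity between indicators rather than a construction: it covers both adding an arc and
-- restoring a removed one, and every sum over arcs changes by one term.
IsExtension : ∀ {n} → Digraph n → Fin n → Fin n → Digraph n → Set
IsExtension A u v A′ = ∀ a b → 𝟙 (A′ a b) ≡ 𝟙 (A a b) + δ a u * δ b v

module _ {n} {A A′ : Digraph n} {u v : Fin n} (ext : IsExtension A u v A′) where
  open ≡-Reasoning

  total-ext : ∀ f → total f A′ ≡ total f A + f u v
  total-ext f = begin
    total f A′
      ≡⟨ sum-cong (λ a → begin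
           sumFin (λ b → 𝟙 (A′ a b) * f a b)
             ≡⟨ sum-cong (λ b → trans (cong (_* f a b) (ext a b)) (expand (𝟙 (A a b)) (δ a u) (δ b v) (f a b))) ⟩
           sumFin (λ b → 𝟙 (A a b) * f a b + δ a u * (δ b v * f a b))
             ≡⟨ sum-+ (λ b → 𝟙 (A a b) * f a b) _ ⟩
           sumFin (λ b → 𝟙 (A a b) * f a b) + sumFin (λ b → δ a u * (δ b v * f a b))
             ≡⟨ cong (sumFin (λ b → 𝟙 (A a b) * f a b) +_) (trans (sum-*ˡ (δ a u) (λ b → δ b v * f a b)) (cong (δ a u *_) (sum-δ (f a) v))) ⟩
           sumFin (λ b → 𝟙 (A a b) * f a b) + δ a u * f a v ∎) ⟩
    sumFin (λ a → sumFin (λ b → 𝟙 (A a b) * f a b) + δ a u * f a v)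
      ≡⟨ sum-+ (λ a → sumFin (λ b → 𝟙 (A a b) * f a b)) _ ⟩
    total f A + sumFin (λ a → δ a u * f a v)
      ≡⟨ cong (total f A +_) (sum-δ (λ a → f a v) u) ⟩
    total f A + f u v ∎
    where
    expand : ∀ x y z w → (x + y * z) * w ≡ x * w + y * (z * w)
    expand = solve-∀

  outDeg-ext : ∀ a → outDeg A′ a ≡ outDeg A a + δ a u
  outDeg-ext a = begin
    outDeg A′ a                                     ≡⟨ sum-cong (ext a) ⟩
    sumFin (λ b → 𝟙 (A a b) + δ a u * δ b v)        ≡⟨ sum-+ (λ b → 𝟙 (A a b)) _ ⟩
    outDeg A a + sumFin (λ b → δ a u * δ b v)       ≡⟨ cong (outDeg A a +_) (sum-*ˡ (δ a u) (λ b → δ b v)) ⟩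
    outDeg A a + δ a u * sumFin (λ b → δ b v)       ≡⟨ cong (λ s → outDeg A a + δ a u * s) (sum-δ₁ v) ⟩
    outDeg A a + δ a u * 1                          ≡⟨ cong (outDeg A a +_) (*-identityʳ _) ⟩
    outDeg A a + δ a u                              ∎

  inDeg-ext : ∀ b → inDeg A′ b ≡ inDeg A b + δ b v
  inDeg-ext b = begin
    inDeg A′ b                                      ≡⟨ sum-cong (λ a → ext a b) ⟩
    sumFin (λ a → 𝟙 (A a b) + δ a u * δ b v)        ≡⟨ sum-+ (λ a → 𝟙 (A a b)) _ ⟩
    inDeg A b + sumFin (λ a → δ a u * δ b v)        ≡⟨ cong (inDeg A b +_) (sum-*ʳ (λ a → δ a u) (δ b v)) ⟩
    inDeg A b + sumFin (λ a → δ a u) * δ b v        ≡⟨ cong (λ s → inDeg A b + s * δ b v) (sum-δ₁ u) ⟩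
    inDeg A b + (δ b v + 0)                         ≡⟨ cong (inDeg A b +_) (+-identityʳ _) ⟩
    inDeg A b + δ b v                               ∎

  arcCount-ext : arcCount A′ ≡ suc (arcCount A)
  arcCount-ext = begin
    sumFin (outDeg A′)                              ≡⟨ sum-cong outDeg-ext ⟩
    sumFin (λ a → outDeg A a + δ a u)               ≡⟨ sum-+ (outDeg A) _ ⟩
    arcCount A + sumFin (λ a → δ a u)               ≡⟨ cong (arcCount A +_) (sum-δ₁ u) ⟩
    arcCount A + 1                                  ≡⟨ +-comm (arcCount A) 1 ⟩
    suc (arcCount A)                                ∎

isArc : ∀ {n} → Fin n → Fin n → Digraph n
isArc u v a b = ⌊ a ≟ u ⌋ ∧ ⌊ b ≟ v ⌋

addArc : ∀ {n} → Digraph n → Fin n → Fin n → Digraph n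
addArc A u v a b = if isArc u v a b then true else A a b

addArc-ext : ∀ {n} (A : Digraph n) {u v} → A u v ≡ false → IsExtension A u v (addArc A u v)
addArc-ext A {u} {v} h a b with a ≟ u | b ≟ v
... | yes refl | yes refl = sym (cong (λ x → 𝟙 x + 1) h)
... | yes _    | no _     = sym (+-identityʳ _)
... | no _     | yes _    = sym (+-identityʳ _)
... | no _     | no _     = sym (+-identityʳ _)

minus-ext : ∀ {n} (A : Digraph n) {u v} → A u v ≡ true → IsExtension (A minus isArc u v) u v A
minus-ext A {u} {v} h a b with a ≟ u | b ≟ v
... | yes refl | yes refl = cong 𝟙 h
... | yes _    | no _     = sym (+-identityʳ _)
... | no _     | yes _    = sym (+-identityʳ _)
... | no _     | no _     = sym (+-identityʳ _)

addArc-⊆ : ∀ {n} (A : Digraph n) u v {a b} → A a b ≡ true → addArc A u v a b ≡ true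
addArc-⊆ A u v {a} {b} h with isArc u v a b
... | true  = refl
... | false = h

addArc⁻ : ∀ {n} (A : Digraph n) u v {a b} → addArc A u v a b ≡ true → A a b ≡ true ⊎ (a ≡ u × b ≡ v)
addArc⁻ A u v {a} {b} h with a ≟ u | b ≟ v
... | yes p | yes q = inj₂ (p , q)
... | yes _ | no _  = inj₁ h
... | no _  | yes _ = inj₁ h
... | no _  | no _  = inj₁ h

minus-⊆ : ∀ {n} (A F : Digraph n) a b → (A minus F) a b ≡ true → A a b ≡ true
minus-⊆ A F a b h with F a b
... | false = h

arcCount-by-heads : ∀ {n} (A : Digraph n) → arcCount A ≡ sumFin (inDeg A)
arcCount-by-heads A = sum-swap (λ a b → 𝟙 (A a b))

-- Walks and partial digraphs

data Walk {n} (A : Digraph n) : Fin n → Fin n → ℕ → Set where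
  stay : ∀ {x} → Walk A x x 0
  step : ∀ {x w y ℓ} → A x w ≡ true → Walk A w y ℓ → Walk A x y (suc ℓ)

_++ʷ_ : ∀ {n} {A : Digraph n} {x y z ℓ₁ ℓ₂} → Walk A x y ℓ₁ → Walk A y z ℓ₂ → Walk A x z (ℓ₁ + ℓ₂)
stay     ++ʷ q = q
step e p ++ʷ q = step e (p ++ʷ q)

mapʷ : ∀ {n} {A B : Digraph n} → (∀ a b → A a b ≡ true → B a b ≡ true) →
  ∀ {x y ℓ} → Walk A x y ℓ → Walk B x y ℓ
mapʷ A⊆B stay       = stay
mapʷ A⊆B (step e p) = step (A⊆B _ _ e) (mapʷ A⊆B p)

-- Closed walks instead of cycles: they can be cut and joined without regard to repeated vertices,
-- and excluding them is the stronger condition. Loops and directed 2-cycles are the closed walks of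
-- lengths 1 and 2.
NoShortClosedWalk : ∀ {n} → ℕ → Digraph n → Set
NoShortClosedWalk g A = ∀ {x ℓ} → suc ℓ < g → ¬ Walk A x x (suc ℓ)

-- In the second case the walk is cut at its first and its last passage through the new arc.
addArc-walk : ∀ {n} (A : Digraph n) u v {x y ℓ} → Walk (addArc A u v) x y ℓ →
  Walk A x y ℓ ⊎ ∃₂ λ ℓ₁ ℓ₂ → Walk A x u ℓ₁ × Walk A v y ℓ₂ × ℓ₁ + ℓ₂ < ℓ
addArc-walk A u v stay = inj₁ stay
addArc-walk A u v (step e p) with addArc⁻ A u v e | addArc-walk A u v p
... | inj₁ e′           | inj₁ p′                       = inj₁ (step e′ p′)
... | inj₁ e′           | inj₂ (ℓ₁ , ℓ₂ , p₁ , p₂ , lt) = inj₂ (suc ℓ₁ , ℓ₂ , step e′ p₁ , p₂ , s≤s lt)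
... | inj₂ (refl , refl) | inj₁ p′                       = inj₂ (0 , _ , stay , p′ , ≤-refl)
... | inj₂ (refl , refl) | inj₂ (ℓ₁ , ℓ₂ , p₁ , p₂ , lt) =
  inj₂ (0 , ℓ₂ , stay , p₂ , s≤s (≤-trans (m≤n+m ℓ₂ ℓ₁) (<⇒≤ lt)))

-- A closed walk through the new arc, rotated so as to begin behind it, contains a walk from `v` to
-- `u` in `A` that is at least one step shorter.
addArc-noShort : ∀ {n g} (A : Digraph n) u v → NoShortClosedWalk g A →
  (∀ {ℓ} → suc ℓ < g → ¬ Walk A v u ℓ) → NoShortClosedWalk g (addArc A u v)
addArc-noShort A u v ns far {ℓ = ℓ} lt p with addArc-walk A u v p
... | inj₁ p′ = ns lt p′
... | inj₂ (ℓ₁ , ℓ₂ , p₁ , p₂ , shorter) =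
  far (≤-trans (s≤s (subst (_< suc ℓ) (+-comm ℓ₁ ℓ₂) shorter)) lt) (p₂ ++ʷ p₁)

record Partial {n} (g k : ℕ) (A : Digraph n) : Set where
  field
    out≤    : ∀ u → outDeg A u ≤ k
    in≤     : ∀ v → inDeg A v ≤ k
    noShort : NoShortClosedWalk g A

open Partial

addArc-partial : ∀ {n g k} (A : Digraph n) {u v} → Partial g k A → A u v ≡ false →
  outDeg A u < k → inDeg A v < k → (∀ {ℓ} → suc ℓ < g → ¬ Walk A v u ℓ) →
  Partial g k (addArc A u v)
addArc-partial {k = k} A {u} {v} P uv∉A out< in< far = record
  { out≤ = λ a → subst (_≤ k) (sym (outDeg-ext ext a)) (bound (outDeg A) u (out≤ P) out< a)
  ; in≤ = λ b → subst (_≤ k) (sym (inDeg-ext ext b)) (bound (inDeg A) v (in≤ P) in< b)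
  ; noShort = addArc-noShort A u v (noShort P) far
  }
  where
  ext = addArc-ext A uv∉A
  bound : ∀ (f : _ → ℕ) u → (∀ a → f a ≤ k) → f u < k → ∀ a → f a + δ a u ≤ k
  bound f u f≤ f< a with a ≟ u
  ... | yes refl = subst (_≤ k) (+-comm 1 (f u)) f<
  ... | no _     = subst (_≤ k) (sym (+-identityʳ (f a))) (f≤ a)

-- Disjoint unions

blocks : ∀ {m n} → Digraph m → Digraph n → Fin m ⊎ Fin n → Fin m ⊎ Fin n → Bool
blocks A B (inj₁ a) (inj₁ b) = A a b
blocks A B (inj₂ a) (inj₂ b) = B a b
blocks A B _        _        = false

_⊕_ : ∀ {m n} → Digraph m → Digraph n → Digraph (m + n)
_⊕_ {m} A B x y = blocks A B (splitAt m x) (splitAt m y)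

sum-split : ∀ m {n} (f : Fin m ⊎ Fin n → ℕ) →
  sumFin (λ x → f (splitAt m {n} x)) ≡ sumFin (f ∘ inj₁) + sumFin (f ∘ inj₂)
sum-split m {n} f = trans (sum-join m _) (cong₂ _+_
  (sum-cong (λ i → cong f (Fin.splitAt-↑ˡ m i n)))
  (sum-cong (λ j → cong f (Fin.splitAt-↑ʳ m n j))))

module _ {m n} (A : Digraph m) (B : Digraph n) where

  outDeg-⊕ : ∀ x → outDeg (A ⊕ B) x ≡ [ outDeg A , outDeg B ]′ (splitAt m x)
  outDeg-⊕ x = trans (sum-split m (λ t → 𝟙 (blocks A B (splitAt m x) t))) (row (splitAt m x))
    where
    row : ∀ s → sumFin (λ b → 𝟙 (blocks A B s (inj₁ b))) + sumFin (λ b → 𝟙 (blocks A B s (inj₂ b)))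
      ≡ [ outDeg A , outDeg B ]′ s
    row (inj₁ a) = trans (cong (outDeg A a +_) (sum-zero n)) (+-identityʳ _)
    row (inj₂ a) = cong (_+ outDeg B a) (sum-zero m)

  inDeg-⊕ : ∀ y → inDeg (A ⊕ B) y ≡ [ inDeg A , inDeg B ]′ (splitAt m y)
  inDeg-⊕ y = trans (sum-split m (λ s → 𝟙 (blocks A B s (splitAt m y)))) (column (splitAt m y))
    where
    column : ∀ t → sumFin (λ a → 𝟙 (blocks A B (inj₁ a) t)) + sumFin (λ a → 𝟙 (blocks A B (inj₂ a) t))
      ≡ [ inDeg A , inDeg B ]′ t
    column (inj₁ b) = trans (cong (inDeg A b +_) (sum-zero n)) (+-identityʳ _)
    column (inj₂ b) = cong (_+ inDeg B b) (sum-zero m)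

  arcCount-⊕ : arcCount (A ⊕ B) ≡ arcCount A + arcCount B
  arcCount-⊕ = trans (sum-cong outDeg-⊕) (sum-split m [ outDeg A , outDeg B ]′)

  BlockWalk : Fin m ⊎ Fin n → Fin m ⊎ Fin n → ℕ → Set
  BlockWalk (inj₁ a) (inj₁ b) ℓ = Walk A a b ℓ
  BlockWalk (inj₂ a) (inj₂ b) ℓ = Walk B a b ℓ
  BlockWalk _        _        ℓ = ⊥

  ⊕-walk : ∀ {x y ℓ} → Walk (A ⊕ B) x y ℓ → BlockWalk (splitAt m x) (splitAt m y) ℓ
  ⊕-walk {x} stay = stayᵇ (splitAt m x)
    where
    stayᵇ : ∀ s → BlockWalk s s 0
    stayᵇ (inj₁ _) = stay
    stayᵇ (inj₂ _) = stay
  ⊕-walk (step {x} {w} {y} e p) = stepᵇ (splitAt m x) (splitAt m w) (splitAt m y) e (⊕-walk p)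
    where
    stepᵇ : ∀ s t r {ℓ} → blocks A B s t ≡ true → BlockWalk t r ℓ → BlockWalk s r (suc ℓ)
    stepᵇ (inj₁ _) (inj₁ _) (inj₁ _) e q = step e q
    stepᵇ (inj₂ _) (inj₂ _) (inj₂ _) e q = step e q

  ⊕-partial : ∀ {g k} → Partial g k A → Partial g k B → Partial g k (A ⊕ B)
  ⊕-partial {g} {k} P Q = record
    { out≤ = λ x → subst (_≤ k) (sym (outDeg-⊕ x)) (side (outDeg A) (outDeg B) (out≤ P) (out≤ Q) (splitAt m x))
    ; in≤ = λ x → subst (_≤ k) (sym (inDeg-⊕ x)) (side (inDeg A) (inDeg B) (in≤ P) (in≤ Q) (splitAt m x))
    ; noShort = λ {x} lt p → noShortᵇ (splitAt m x) lt (⊕-walk p)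
    }
    where
    side : ∀ (f : Fin m → ℕ) (h : Fin n → ℕ) → (∀ i → f i ≤ k) → (∀ i → h i ≤ k) → ∀ s → [ f , h ]′ s ≤ k
    side f h f≤ h≤ (inj₁ i) = f≤ i
    side f h f≤ h≤ (inj₂ i) = h≤ i
    noShortᵇ : ∀ s {ℓ} → suc ℓ < g → ¬ BlockWalk s s (suc ℓ)
    noShortᵇ (inj₁ _) = noShort P
    noShortᵇ (inj₂ _) = noShort Q

-- Cyclic blow-ups

sum-last : ∀ {m} (f : Fin (suc m) → ℕ) → sumFin f ≡ f (fromℕ m) + sumFin (f ∘ inject₁)
sum-last {zero}  f = refl
sum-last {suc m} f rewrite sum-last (f ∘ suc) = swap (f zero) (f (suc (fromℕ m))) _
  where
  swap : ∀ a b c → a + (b + c) ≡ b + (a + c)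
  swap = solve-∀

predMod : ∀ {m} → Fin (suc m) → Fin (suc m)
predMod {m} zero = fromℕ m
predMod (suc i)  = inject₁ i

predMod-toℕ : ∀ {m} (j : Fin (suc m)) → ∃[ c ] suc (toℕ (predMod j)) ≡ toℕ j + c * suc m
predMod-toℕ {m} zero    = 1 , trans (cong suc (Fin.toℕ-fromℕ m)) (sym (+-identityʳ (suc m)))
predMod-toℕ     (suc j) = 0 , trans (cong suc (Fin.toℕ-inject₁ j)) (sym (+-identityʳ _))

δ-sym : ∀ {n} (i j : Fin n) → δ i j ≡ δ j i
δ-sym i j with i ≟ j | j ≟ i
... | yes _    | yes _   = refl
... | no _     | no _    = refl
... | yes i≡j  | no j≢i  = contradiction (sym i≡j) j≢i
... | no i≢j   | yes j≡i = contradiction (sym j≡i) i≢j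

layer : ∀ {m} k → Fin (m * k) → Fin m
layer k x = proj₁ (remQuot k x)

sum-layers : ∀ m k (f : Fin m → ℕ) → sumFin {m * k} (λ x → f (layer {m} k x)) ≡ k * sumFin f
sum-layers m k f = begin
  sumFin {m * k} (λ x → f (layer {m} k x))                              ≡⟨ sum-combine m {k} (λ x → f (layer {m} k x)) ⟩
  sumFin (λ i → sumFin {k} (λ j → f (layer {m} k (combine {m} i j))))   ≡⟨ sum-cong (λ i →
    trans (sum-cong (λ j → cong (f ∘ proj₁) (Fin.remQuot-combine {m} {k} i j))) (sum-const k (f i))) ⟩
  sumFin (λ i → k * f i)                                            ≡⟨ sum-*ˡ k f ⟩
  k * sumFin f                                                      ∎
  where open ≡-Reasoning

cyclicBlowUp : ∀ m k → Digraph (suc m * k)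
cyclicBlowUp m k a b = ⌊ layer {suc m} k a ≟ predMod (layer {suc m} k b) ⌋

cyclicBlowUp-outDeg : ∀ m k a → outDeg (cyclicBlowUp m k) a ≡ k
cyclicBlowUp-outDeg m k a = begin
  outDeg (cyclicBlowUp m k) a            ≡⟨ sum-layers (suc m) k (λ j → δ i (predMod j)) ⟩
  k * sumFin (λ j → δ i (predMod j))     ≡⟨ cong (k *_) (sum-last (δ i)) ⟨
  k * sumFin (δ i)                       ≡⟨ cong (k *_) (trans (sum-cong (δ-sym i)) (sum-δ₁ i)) ⟩
  k * 1                                  ≡⟨ *-identityʳ k ⟩
  k                                      ∎
  where
  open ≡-Reasoning
  i = layer {suc m} k a

cyclicBlowUp-inDeg : ∀ m k b → inDeg (cyclicBlowUp m k) b ≡ k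
cyclicBlowUp-inDeg m k b = begin
  inDeg (cyclicBlowUp m k) b             ≡⟨ sum-layers (suc m) k (λ i → δ i j) ⟩
  k * sumFin (λ i → δ i j)               ≡⟨ cong (k *_) (sum-δ₁ j) ⟩
  k * 1                                  ≡⟨ *-identityʳ k ⟩
  k                                      ∎
  where
  open ≡-Reasoning
  j = predMod (layer {suc m} k b)

-- Each arc raises the layer by one modulo `suc m`, and `c` counts the passages from the last layer
-- to the first. For a closed walk the layers cancel, so its length is a multiple of `suc m`.
cyclicBlowUp-walk : ∀ m k {a b ℓ} → Walk (cyclicBlowUp m k) a b ℓ →
  ∃[ c ] toℕ (layer {suc m} k a) + ℓ ≡ toℕ (layer {suc m} k b) + c * suc m
cyclicBlowUp-walk m k stay = 0 , refl
cyclicBlowUp-walk m k {a} {b} (step {w = w} {ℓ = ℓ} e p)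
  with layer {suc m} k a ≟ predMod (layer {suc m} k w)
... | yes i≡ with predMod-toℕ (layer {suc m} k w) | cyclicBlowUp-walk m k p
...   | c , h | c′ , h′ = c + c′ , (begin
  toℕ (layer {suc m} k a) + suc ℓ                        ≡⟨ +-suc _ ℓ ⟩
  suc (toℕ (layer {suc m} k a)) + ℓ                      ≡⟨ cong (λ i → suc (toℕ i) + ℓ) i≡ ⟩
  suc (toℕ (predMod (layer {suc m} k w))) + ℓ            ≡⟨ cong (_+ ℓ) h ⟩
  toℕ (layer {suc m} k w) + c * suc m + ℓ                ≡⟨ shift (toℕ (layer {suc m} k w)) (c * suc m) ℓ ⟩
  toℕ (layer {suc m} k w) + ℓ + c * suc m                ≡⟨ cong (_+ c * suc m) h′ ⟩
  toℕ (layer {suc m} k b) + c′ * suc m + c * suc m       ≡⟨ regroup (toℕ (layer {suc m} k b)) c c′ (suc m) ⟩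
  toℕ (layer {suc m} k b) + (c + c′) * suc m             ∎)
  where
  open ≡-Reasoning
  shift : ∀ x y z → x + y + z ≡ x + z + y
  shift = solve-∀
  regroup : ∀ x c c′ s → x + c′ * s + c * s ≡ x + (c + c′) * s
  regroup = solve-∀

cyclicBlowUp-noShort : ∀ m k → NoShortClosedWalk (suc m) (cyclicBlowUp m k)
cyclicBlowUp-noShort m k {a} {ℓ} lt p with cyclicBlowUp-walk m k p
... | zero  , h = contradiction (+-cancelˡ-≡ (toℕ (layer {suc m} k a)) (suc ℓ) 0 h) λ ()
... | suc c , h = <⇒≱ lt (≤-trans (m≤m+n (suc m) (c * suc m))
  (≤-reflexive (sym (+-cancelˡ-≡ (toℕ (layer {suc m} k a)) _ _ h))))

⌊≟⌋-refl : ∀ {n} (i : Fin n) → ⌊ i ≟ i ⌋ ≡ true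
⌊≟⌋-refl i with i ≟ i
... | yes _  = refl
... | no i≢i = contradiction refl i≢i

-- What is left of a k-regular digraph on `M` vertices when one arc from `exit` to `entry` is
-- removed; the detour enters at the head and leaves at the tail of that arc. The field `far` keeps
-- closed walks through the detour long whatever vertices of `A` it joins, be they equal or
-- adjacent.
record Gadget (g k M : ℕ) : Set where
  field
    H          : Digraph M
    partial    : Partial g k H
    entry exit : Fin M
    out-full   : ∀ a → outDeg H a + δ a exit ≡ k
    in-full    : ∀ b → inDeg H b + δ b entry ≡ k
    far        : ∀ {ℓ} → suc ℓ < g → ¬ Walk H entry exit ℓ
    size       : suc (arcCount H) ≡ k * M

gadget : ∀ m k → Gadget (suc m) (suc k) (suc m * suc k)
gadget m k = record
  { H = H′
  ; partial = record
      { out≤ = λ a → m+n≤o⇒m≤o _ (≤-reflexive (out-full a))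
      ; in≤ = λ b → m+n≤o⇒m≤o _ (≤-reflexive (in-full b))
      ; noShort = λ lt p → noShort-H lt (mapʷ (minus-⊆ H (isArc x y)) p)
      }
  ; entry = y
  ; exit = x
  ; out-full = out-full
  ; in-full = in-full
  -- A walk from `entry` to `exit` would be closed by the removed arc.
  ; far = λ lt p → noShort-H lt (step x→y (mapʷ (minus-⊆ H (isArc x y)) p))
  ; size = trans (sym (arcCount-ext ext)) (trans (sum-cong (cyclicBlowUp-outDeg m (suc k)))
      (trans (sum-const (suc m * suc k) (suc k)) (*-comm (suc m * suc k) (suc k))))
  }
  where
  H = cyclicBlowUp m (suc k)
  noShort-H = cyclicBlowUp-noShort m (suc k)
  x y : Fin (suc m * suc k)
  x = combine {suc m} (fromℕ m) zero
  y = combine {suc m} zero zero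
  x→y : H x y ≡ true
  x→y = trans
    (cong₂ (λ i j → ⌊ proj₁ i ≟ predMod (proj₁ j) ⌋)
      (Fin.remQuot-combine {suc m} {suc k} (fromℕ m) zero)
      (Fin.remQuot-combine {suc m} {suc k} zero zero))
    (⌊≟⌋-refl (fromℕ m))
  H′ = H minus isArc x y
  ext = minus-ext H x→y
  out-full : ∀ a → outDeg H′ a + δ a x ≡ suc k
  out-full a = trans (sym (outDeg-ext ext a)) (cyclicBlowUp-outDeg m (suc k) a)
  in-full : ∀ b → inDeg H′ b + δ b y ≡ suc k
  in-full b = trans (sym (inDeg-ext ext b)) (cyclicBlowUp-inDeg m (suc k) b)

-- Completion of partial digraphs to regular ones

-- Twice, because the bound comes from a cut, which counts the arcs leaving a set together with
-- those entering it, while only the former must lie in `F`.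
TwiceFasAtLeast : ∀ {n} → ℕ → Digraph n → Set
TwiceFasAtLeast X A = ∀ F → IsFAS A F → X ≤ 2 * arcCount F

-- A feedback arc set of `D`, pulled back along `ι`, is one of `A`, since a cycle of `A` that avoids
-- it is mapped to a cycle of `D`. Thus the completion, which only adds vertices and arcs, inherits
-- the bound of the greedy digraph.
fas-embedding : ∀ {n n′ X} (A : Digraph n) (D : Digraph n′) (ι : Fin n → Fin n′) →
  (∀ {a b} → ι a ≡ ι b → a ≡ b) → (∀ {a b} → A a b ≡ true → D (ι a) (ι b) ≡ true) →
  (∀ F → arcCount (λ a b → F (ι a) (ι b)) ≤ arcCount F) →
  TwiceFasAtLeast X A → TwiceFasAtLeast X D
fas-embedding {X = X} A D ι ι-inj arcs shrink lower F (F⊆D , acyclic) = begin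
  X                                     ≤⟨ lower F′ (F′⊆A , acyclic′) ⟩
  2 * arcCount F′                       ≤⟨ *-monoʳ-≤ 2 (sum-mono (λ a → sum-mono (λ b → 𝟙-∧ (A a b) (F (ι a) (ι b))))) ⟩
  2 * arcCount (λ a b → F (ι a) (ι b))  ≤⟨ *-monoʳ-≤ 2 (shrink F) ⟩
  2 * arcCount F                        ∎
  where
  open ≤-Reasoning
  F′ : Digraph _
  F′ a b = A a b ∧ F (ι a) (ι b)
  𝟙-∧ : ∀ x y → 𝟙 (x ∧ y) ≤ 𝟙 y
  𝟙-∧ true  y = ≤-refl
  𝟙-∧ false y = z≤n
  F′⊆A : ∀ a b → F′ a b ≡ true → A a b ≡ true
  F′⊆A a b h with A a b
  ... | true = refl
  lift : ∀ {a b} → (A minus F′) a b ≡ true → (D minus F) (ι a) (ι b) ≡ true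
  lift {a} {b} h with A a b in eq | F (ι a) (ι b)
  ... | true | false = arcs eq
  acyclic′ : Acyclic (A minus F′)
  acyclic′ len C = acyclic len record
    { k = DirCycle.k C
    ; len≡ = DirCycle.len≡ C
    ; v = ι ∘ DirCycle.v C
    ; inj = λ e → DirCycle.inj C (ι-inj e)
    ; step = λ i → lift (DirCycle.step C i)
    ; close = lift (DirCycle.close C)
    }

fas-addArc : ∀ {n X} (A : Digraph n) u v → TwiceFasAtLeast X A → TwiceFasAtLeast X (addArc A u v)
fas-addArc A u v = fas-embedding A (addArc A u v) (λ a → a) (λ e → e) (addArc-⊆ A u v) (λ _ → ≤-refl)

fas-⊕ : ∀ {m n X} (A : Digraph m) (B : Digraph n) → TwiceFasAtLeast X A → TwiceFasAtLeast X (A ⊕ B)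
fas-⊕ {m} {n} A B = fas-embedding A (A ⊕ B) (_↑ˡ n) (Fin.↑ˡ-injective n _ _)
  (λ {a} {b} h → trans (cong₂ (blocks A B) (Fin.splitAt-↑ˡ m a n) (Fin.splitAt-↑ˡ m b n)) h)
  λ F → ≤-trans (sum-mono (λ a → ≤-trans (m≤m+n _ _) (≤-reflexive (sym (sum-join m (λ b → 𝟙 (F (a ↑ˡ n) b)))))))
    (≤-trans (m≤m+n _ _) (≤-reflexive (sym (sum-join m (outDeg F)))))

↑ˡ≢↑ʳ : ∀ {m n} (i : Fin m) (j : Fin n) → i ↑ˡ n ≢ m ↑ʳ j
↑ˡ≢↑ʳ {m} {n} i j e with trans (sym (Fin.splitAt-↑ˡ m i n)) (trans (cong (splitAt m) e) (Fin.splitAt-↑ʳ m n j))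
... | ()

δ-≢ : ∀ {n} {i j : Fin n} → i ≢ j → δ i j ≡ 0
δ-≢ {i = i} {j} i≢j with i ≟ j
... | yes e = contradiction e i≢j
... | no _  = refl

¬true⇒false : ∀ {b} → b ≢ true → b ≡ false
¬true⇒false = Bool.¬-not

-- A missing arc u → v is replaced by a detour through a fresh gadget.
complete-step : ∀ {n g k M X r} → Gadget g k M → (A : Digraph n) → Partial g k A →
  arcCount A + suc r ≡ k * n → TwiceFasAtLeast X A →
  ∃[ D ] Partial {n + M} g k D × arcCount D + r ≡ k * (n + M) × TwiceFasAtLeast X D
complete-step {n} {g} {k} {M} {X} {r} G A P deficit lower =
  D₂ , P₂ , count₂ , fas-addArc D₁ _ _ (fas-addArc D₀ _ _ (fas-⊕ A H lower))
  where
  open Gadget G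
  arcs< : arcCount A < k * n
  arcs< = subst (suc (arcCount A) ≤_) (trans (sym (+-suc _ r)) deficit) (s≤s (m≤m+n _ r))
  uᵈ = ∃-below-constant k (outDeg A) arcs<
  vᵈ = ∃-below-constant k (inDeg A) (subst (_< k * n) (arcCount-by-heads A) arcs<)
  u v x y : Fin (n + M)
  u = proj₁ uᵈ ↑ˡ M
  v = proj₁ vᵈ ↑ˡ M
  x = n ↑ʳ exit
  y = n ↑ʳ entry
  D₀ = A ⊕ H
  D₁ = addArc D₀ u y
  D₂ = addArc D₁ x v
  u→y∉D₀ : D₀ u y ≡ false
  u→y∉D₀ = cong₂ (blocks A H) (Fin.splitAt-↑ˡ n _ M) (Fin.splitAt-↑ʳ n M _)
  x→v∉D₁ : D₁ x v ≡ false
  x→v∉D₁ = ¬true⇒false λ h → case addArc⁻ D₀ u y h of λ where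
    (inj₁ h₀) → case trans (sym (cong₂ (blocks A H) (Fin.splitAt-↑ʳ n M _) (Fin.splitAt-↑ˡ n _ M))) h₀ of λ ()
    (inj₂ (x≡u , _)) → ↑ˡ≢↑ʳ _ _ (sym x≡u)
  ext₁ = addArc-ext D₀ u→y∉D₀
  ext₂ = addArc-ext D₁ x→v∉D₁
  block-walk : ∀ {s t a b ℓ} → splitAt n s ≡ a → splitAt n t ≡ b → Walk D₀ s t ℓ → BlockWalk A H a b ℓ
  block-walk refl refl = ⊕-walk A H
  exit< : outDeg H exit < k
  exit< = ≤-reflexive (trans (+-comm 1 _) (trans (cong (outDeg H exit +_) (sym (δ-refl exit))) (out-full exit)))
  entry< : inDeg H entry < k
  entry< = ≤-reflexive (trans (+-comm 1 _) (trans (cong (inDeg H entry +_) (sym (δ-refl entry))) (in-full entry)))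
  P₁ : Partial g k D₁
  P₁ = addArc-partial D₀ (⊕-partial A H P partial) u→y∉D₀
    (subst (_< k) (sym (trans (outDeg-⊕ A H u) (cong [ outDeg A , outDeg H ]′ (Fin.splitAt-↑ˡ n _ M)))) (proj₂ uᵈ))
    (subst (_< k) (sym (trans (inDeg-⊕ A H y) (cong [ inDeg A , inDeg H ]′ (Fin.splitAt-↑ʳ n M _)))) entry<)
    (λ _ p → block-walk (Fin.splitAt-↑ʳ n M _) (Fin.splitAt-↑ˡ n _ M) p)
  out-x : outDeg D₁ x ≡ outDeg H exit
  out-x = trans (outDeg-ext ext₁ x) (trans (cong₂ _+_
    (trans (outDeg-⊕ A H x) (cong [ outDeg A , outDeg H ]′ (Fin.splitAt-↑ʳ n M _)))
    (δ-≢ (λ e → ↑ˡ≢↑ʳ _ _ (sym e)))) (+-identityʳ _))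
  in-v : inDeg D₁ v ≡ inDeg A (proj₁ vᵈ)
  in-v = trans (inDeg-ext ext₁ v) (trans (cong₂ _+_
    (trans (inDeg-⊕ A H v) (cong [ inDeg A , inDeg H ]′ (Fin.splitAt-↑ˡ n _ M)))
    (δ-≢ (↑ˡ≢↑ʳ _ _))) (+-identityʳ _))
  v⇝x-long : ∀ {ℓ} → suc ℓ < g → ¬ Walk D₁ v x ℓ
  v⇝x-long lt p with addArc-walk D₀ u y p
  ... | inj₁ p₀ = block-walk (Fin.splitAt-↑ˡ n _ M) (Fin.splitAt-↑ʳ n M _) p₀
  ... | inj₂ (ℓ₁ , ℓ₂ , _ , p₂ , shorter) =
    far (≤-trans (s≤s (s≤s (≤-trans (m≤n+m ℓ₂ ℓ₁) (<⇒≤ shorter)))) lt)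
      (block-walk (Fin.splitAt-↑ʳ n M _) (Fin.splitAt-↑ʳ n M _) p₂)
  P₂ : Partial g k D₂
  P₂ = addArc-partial D₁ P₁ x→v∉D₁ (subst (_< k) (sym out-x) exit<)
    (subst (_< k) (sym in-v) (proj₂ vᵈ)) v⇝x-long
  count₂ : arcCount D₂ + r ≡ k * (n + M)
  count₂ = begin
    arcCount D₂ + r                            ≡⟨ cong (_+ r) (trans (arcCount-ext ext₂) (cong suc (arcCount-ext ext₁))) ⟩
    2 + arcCount D₀ + r                        ≡⟨ cong (λ s → 2 + s + r) (arcCount-⊕ A H) ⟩
    2 + (arcCount A + arcCount H) + r          ≡⟨ regroup (arcCount A) (arcCount H) r ⟩
    (arcCount A + suc r) + suc (arcCount H)    ≡⟨ cong₂ _+_ deficit size ⟩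
    k * n + k * M                              ≡⟨ *-distribˡ-+ k n M ⟨
    k * (n + M)                                ∎
    where
    open ≡-Reasoning
    regroup : ∀ a h r → 2 + (a + h) + r ≡ (a + suc r) + suc h
    regroup = solve-∀

saturated : ∀ {n k} (f : Fin n → ℕ) → (∀ i → f i ≤ k) → sumFin f ≡ k * n → ∀ i → f i ≡ k
saturated {n} {k} f f≤ full i = ≤-antisym (f≤ i) (m∸n≡0⇒m≤n (sum≡0 (λ j → k ∸ f j) slack≡0 i))
  where
  slack≡0 : sumFin (λ j → k ∸ f j) ≡ 0
  slack≡0 = +-cancelˡ-≡ (sumFin f) _ 0 (begin
    sumFin f + sumFin (λ j → k ∸ f j)     ≡⟨ sum-+ f _ ⟨
    sumFin (λ j → f j + (k ∸ f j))        ≡⟨ sum-cong (λ j → m+[n∸m]≡n (f≤ j)) ⟩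
    sumFin {n} (λ _ → k)                  ≡⟨ sum-const n k ⟩
    n * k                                 ≡⟨ *-comm n k ⟩
    k * n                                 ≡⟨ full ⟨
    sumFin f                              ≡⟨ +-identityʳ _ ⟨
    sumFin f + 0                          ∎)
    where open ≡-Reasoning

complete : ∀ {n g k M X} → Gadget g k M → ∀ r (A : Digraph n) → Partial g k A →
  arcCount A + r ≡ k * n → TwiceFasAtLeast X A →
  ∃[ D ] Regular {n + r * M} k D × NoShortClosedWalk g D × TwiceFasAtLeast X D
complete {n} {g} {k} {M} {X} G zero A P full lower =
  subst (λ n′ → ∃[ D ] Regular {n′} k D × NoShortClosedWalk g D × TwiceFasAtLeast X D) (sym (+-identityʳ n))
    (A , (λ u → saturated (outDeg A) (out≤ P) full′ u ,
                saturated (inDeg A) (in≤ P) (trans (sym (arcCount-by-heads A)) full′) u) , noShort P , lower)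
  where
  full′ = trans (sym (+-identityʳ _)) full
complete {n} {g} {k} {M} {X} G (suc r) A P deficit lower with complete-step G A P deficit lower
... | D , P′ , deficit′ , lower′ =
  subst (λ n′ → ∃[ D ] Regular {n′} k D × NoShortClosedWalk g D × TwiceFasAtLeast X D) (+-assoc n M (r * M))
    (complete G r D P′ deficit′ lower′)

-- Sums over arcs by tails and by heads

total-cong : ∀ {n} (A : Digraph n) {f h : Fin n → Fin n → ℕ} → (∀ a b → f a b ≡ h a b) → total f A ≡ total h A
total-cong A f≡h = sum-cong (λ a → sum-cong (λ b → cong (𝟙 (A a b) *_) (f≡h a b)))

total-+ : ∀ {n} (A : Digraph n) (f h : Fin n → Fin n → ℕ) →
  total (λ a b → f a b + h a b) A ≡ total f A + total h A
total-+ A f h = trans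
  (sum-cong (λ a → trans (sum-cong (λ b → *-distribˡ-+ (𝟙 (A a b)) (f a b) (h a b)))
    (sum-+ (λ b → 𝟙 (A a b) * f a b) (λ b → 𝟙 (A a b) * h a b))))
  (sum-+ (λ a → sumFin (λ b → 𝟙 (A a b) * f a b)) (λ a → sumFin (λ b → 𝟙 (A a b) * h a b)))

total-tails : ∀ {n} (A : Digraph n) (f : Fin n → ℕ) → total (λ a b → f a) A ≡ sumFin (λ a → f a * outDeg A a)
total-tails A f = sum-cong (λ a → trans (sum-*ʳ (λ b → 𝟙 (A a b)) (f a)) (*-comm (outDeg A a) (f a)))

total-heads : ∀ {n} (A : Digraph n) (f : Fin n → ℕ) → total (λ a b → f b) A ≡ sumFin (λ b → f b * inDeg A b)
total-heads A f = trans (sum-swap (λ a b → 𝟙 (A a b) * f b))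
  (sum-cong (λ b → trans (sum-*ʳ (λ a → 𝟙 (A a b)) (f b)) (*-comm (inDeg A b) (f b))))

-- Closed walks and directed cycles

path : ∀ {n} {A : Digraph n} {k} (v : Fin (suc k) → Fin n) →
  (∀ (i : Fin k) → A (v (inject₁ i)) (v (suc i)) ≡ true) → Walk A (v zero) (v (fromℕ k)) k
path {k = zero}  v arcs = stay
path {k = suc k} v arcs = step (arcs zero) (path (v ∘ suc) (arcs ∘ suc))

cycle⇒closedWalk : ∀ {n len} {A : Digraph n} → DirCycle A len → ∃₂ λ x ℓ → len ≡ suc ℓ × Walk A x x (suc ℓ)
cycle⇒closedWalk {A = A} C = v zero , k , len≡ , subst (Walk A _ _) (+-comm k 1) (path v step′ ++ʷ step close stay)
  where open DirCycle C renaming (step to step′)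

noShort⇒girth : ∀ {n g} {A : Digraph n} → NoShortClosedWalk g A → GirthAtLeast g A
noShort⇒girth ns len len<g C with cycle⇒closedWalk C
... | x , ℓ , refl , p = ns len<g p

noShort⇒oriented : ∀ {n g} {A : Digraph n} → 3 ≤ g → NoShortClosedWalk g A → Oriented A
noShort⇒oriented 3≤g ns =
  (λ u → ¬true⇒false (λ e → ns (≤-trans (s≤s (s≤s z≤n)) 3≤g) (step e stay))) ,
  (λ u v e → ¬true⇒false (λ e′ → ns 3≤g (step e (step e′ stay))))

InjectiveBelow : ∀ {n} → (ℕ → Fin n) → ℕ → Set
InjectiveBelow f j = ∀ {a b} → a < j → b < j → f a ≡ f b → a ≡ b

-- Searching for the first repetition, not just any, gives distinctness of all earlier values; this
-- makes the cycle cut out of an infinite walk simple, as `DirCycle` demands.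
first-repetition-below : ∀ {n} (f : ℕ → Fin n) j →
  (∃₂ λ i j → i < j × f i ≡ f j × InjectiveBelow f j) ⊎ InjectiveBelow f j
first-repetition-below f zero = inj₂ λ ()
first-repetition-below f (suc j) with first-repetition-below f j
... | inj₁ found = inj₁ found
... | inj₂ inj with Fin.any? (λ (a : Fin j) → f (toℕ a) ≟ f j)
...   | yes (a , e) = inj₁ (toℕ a , j , Fin.toℕ<n a , e , inj)
...   | no new = inj₂ inj′
  where
  fresh : ∀ {a} → a < j → f a ≢ f j
  fresh a<j e = new (fromℕ< a<j , trans (cong f (Fin.toℕ-fromℕ< a<j)) e)
  inj′ : InjectiveBelow f (suc j)
  inj′ (s≤s a≤j) (s≤s b≤j) e with m≤n⇒m<n∨m≡n a≤j | m≤n⇒m<n∨m≡n b≤j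
  ... | inj₁ a<j  | inj₁ b<j  = inj a<j b<j e
  ... | inj₁ a<j  | inj₂ refl = contradiction e (fresh a<j)
  ... | inj₂ refl | inj₁ b<j  = contradiction (sym e) (fresh b<j)
  ... | inj₂ refl | inj₂ refl = refl

first-repetition : ∀ {n} (f : ℕ → Fin n) → ∃₂ λ i j → i < j × f i ≡ f j × InjectiveBelow f j
first-repetition {n} f with first-repetition-below f (suc n)
... | inj₁ found = found
... | inj₂ inj with Fin.pigeonhole (n<1+n n) (f ∘ toℕ)
...   | i , j , i<j , e = contradiction (inj (Fin.toℕ<n i) (Fin.toℕ<n j) e) (<⇒≢ i<j)

infinite-walk⇒cycle : ∀ {n} (A : Digraph n) (f : ℕ → Fin n) → (∀ i → A (f i) (f (suc i)) ≡ true) →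
  ∃[ len ] DirCycle A len
infinite-walk⇒cycle A f arcs with first-repetition f
... | i , j , i<j , e , inj with m≤n⇒∃[o]m+o≡n i<j
... | k , refl = suc k , record
  { k = k
  ; len≡ = refl
  ; v = λ t → f (i + toℕ t)
  ; inj = λ {s} {t} eq → Fin.toℕ-injective (+-cancelˡ-≡ i _ _ (inj (bound s) (bound t) eq))
  ; step = λ t → subst₂ (λ a b → A (f a) (f b) ≡ true)
      (cong (i +_) (sym (Fin.toℕ-inject₁ t))) (sym (+-suc i (toℕ t))) (arcs (i + toℕ t))
  ; close = subst₂ (λ a x → A (f a) x ≡ true) (cong (i +_) (sym (Fin.toℕ-fromℕ k)))
      (trans (sym e) (cong f (sym (+-identityʳ i)))) (arcs (i + k))
  }
  where
  bound : ∀ (t : Fin (suc k)) → i + toℕ t < suc i + k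
  bound t = s≤s (+-monoʳ-≤ i (s≤s⁻¹ (Fin.toℕ<n t)))

-- Feedback arc sets and cuts

OutClosed : ∀ {n} → Digraph n → (Fin n → Bool) → Set
OutClosed A S = ∀ u v → A u v ≡ true → S u ≡ true → S v ≡ true

-- Otherwise every vertex outside `S` has an out-neighbour outside `S`, and following these forever
-- produces a cycle.
∃-absorbed : ∀ {n} (A : Digraph n) → Acyclic A → ∀ S → count S < n →
  ∃[ v ] S v ≡ false × (∀ w → A v w ≡ true → S w ≡ true)
∃-absorbed {n} A acyclic S S<n
  with Fin.any? (λ v → (S v Bool.≟ false) ×-dec Fin.all? (λ w → (A v w Bool.≟ true) →-dec (S w Bool.≟ true)))
... | yes found = found
... | no none = ⊥-elim (acyclic _ (proj₂ (infinite-walk⇒cycle A (proj₁ ∘ walk) arcs)))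
  where
  Outside : Set
  Outside = ∃[ v ] S v ≡ false
  start : Outside
  start with ∃-below-constant 1 (𝟙 ∘ S) (subst (count S <_) (sym (+-identityʳ n)) S<n)
  ... | v , lt with S v in eq
  ...   | false = v , eq
  ...   | true  = contradiction lt (<-irrefl refl)
  escape : ∀ (o : Outside) → ∃[ w ] S w ≡ false × A (proj₁ o) w ≡ true
  escape (v , v∉S) with Fin.¬∀⟶∃¬ n (λ w → A v w ≡ true → S w ≡ true)
    (λ w → (A v w Bool.≟ true) →-dec (S w Bool.≟ true)) (λ all → none (v , v∉S , all))
  ... | w , bad with A v w in eq
  ...   | true  = w , ¬true⇒false (λ w∈S → bad (λ _ → w∈S)) , eq
  ...   | false = contradiction (λ ()) bad
  walk : ℕ → Outside
  walk zero    = start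
  walk (suc i) = let (w , w∉S , _) = escape (walk i) in w , w∉S
  arcs : ∀ i → A (proj₁ (walk i)) (proj₁ (walk (suc i))) ≡ true
  arcs i = proj₂ (proj₂ (escape (walk i)))

-- Absorbing one sink of the remainder at a time yields the final segments of a topological order,
-- without constructing the order. Applied to the complement of a feedback arc set at half of the
-- vertices, it gives the set whose leaving arcs are all in the feedback arc set.
∃-outClosed : ∀ {n} (A : Digraph n) → Acyclic A → ∀ j → j ≤ n → ∃[ S ] count S ≡ j × OutClosed A S
∃-outClosed {n} A acyclic zero j≤n = (λ _ → false) , sum-zero n , λ u v _ ()
∃-outClosed {n} A acyclic (suc j) j<n with ∃-outClosed A acyclic j (<⇒≤ j<n)
... | S , refl , closed with ∃-absorbed A acyclic S j<n
... | v , v∉S , absorbed = S′ ,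
  trans (sum-cong grow) (trans (sum-+ (𝟙 ∘ S) _) (trans (cong (count S +_) (sum-δ₁ v)) (+-comm (count S) 1))) ,
  closed′
  where
  S′ : Fin n → Bool
  S′ a = if ⌊ a ≟ v ⌋ then true else S a
  grow : ∀ a → 𝟙 (S′ a) ≡ 𝟙 (S a) + δ a v
  grow a with a ≟ v
  ... | yes refl = sym (cong (λ b → 𝟙 b + 1) v∉S)
  ... | no _     = sym (+-identityʳ _)
  S⊆S′ : ∀ {a} → S a ≡ true → S′ a ≡ true
  S⊆S′ {a} a∈S with ⌊ a ≟ v ⌋
  ... | true  = refl
  ... | false = a∈S
  closed′ : OutClosed A S′
  closed′ a b e a∈S′ with a ≟ v
  ... | yes refl = S⊆S′ (absorbed b e)
  ... | no _     = S⊆S′ (closed a b e a∈S′)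

cut : ∀ {n} → (Fin n → Bool) → Digraph n → ℕ
cut S = total (λ a b → 𝟙 (S a xor S b))

-- The arcs leaving S lie in F; the arcs entering S are as many, up to the missing arcs.
cut≤ : ∀ {n g k r} (A F : Digraph n) → Partial g k A → arcCount A + r ≡ k * n →
  ∀ S → OutClosed (A minus F) S → cut S A ≤ 2 * arcCount F + r
cut≤ {n} {g} {k} {r} A F P deficit S closed = begin
  cut S A                          ≡⟨ total-cong A (λ a b → xor-split (S a) (S b)) ⟩
  total (λ a b → 𝟙 (S a ∧ not (S b)) + 𝟙 (not (S a) ∧ S b)) A ≡⟨ total-+ A _ _ ⟩
  leaving + entering               ≤⟨ +-monoʳ-≤ leaving entering≤ ⟩
  leaving + (leaving + r)          ≤⟨ +-mono-≤ leaving≤F (+-monoˡ-≤ r leaving≤F) ⟩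
  arcCount F + (arcCount F + r)    ≡⟨ double (arcCount F) r ⟩
  2 * arcCount F + r               ∎
  where
  open ≤-Reasoning
  double : ∀ x y → x + (x + y) ≡ 2 * x + y
  double = solve-∀
  leaving entering inside : ℕ
  leaving  = total (λ a b → 𝟙 (S a ∧ not (S b))) A
  entering = total (λ a b → 𝟙 (not (S a) ∧ S b)) A
  inside   = total (λ a b → 𝟙 (S a ∧ S b)) A
  xor-split : ∀ x y → 𝟙 (x xor y) ≡ 𝟙 (x ∧ not y) + 𝟙 (not x ∧ y)
  xor-split true  true  = refl
  xor-split true  false = refl
  xor-split false true  = refl
  xor-split false false = refl
  tail-split : ∀ x y → 𝟙 x ≡ 𝟙 (x ∧ not y) + 𝟙 (x ∧ y)
  tail-split true  true  = refl
  tail-split true  false = refl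
  tail-split false y     = refl
  head-split : ∀ x y → 𝟙 y ≡ 𝟙 (not x ∧ y) + 𝟙 (x ∧ y)
  head-split true  y     = refl
  head-split false true  = refl
  head-split false false = refl
  leaving≤F : leaving ≤ arcCount F
  leaving≤F = sum-mono (λ a → sum-mono (λ b → in-F a b))
    where
    in-F : ∀ a b → 𝟙 (A a b) * 𝟙 (S a ∧ not (S b)) ≤ 𝟙 (F a b)
    in-F a b with F a b in f | A a b in e
    ... | _     | false = z≤n
    ... | true  | true  = ≤-trans (≤-reflexive (+-identityʳ _)) (𝟙≤1 (S a ∧ not (S b)))
    ... | false | true with S a in s | S b in t
    ...   | false | _     = z≤n
    ...   | true  | true  = z≤n
    ...   | true  | false with trans (sym t) (closed a b (trans (cong (λ x → if x then false else A a b) f) e) s)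
    ...     | ()
  heads : entering + inside ≤ k * count S
  heads = begin
    entering + inside                              ≡⟨ total-+ A _ _ ⟨
    total (λ a b → 𝟙 (not (S a) ∧ S b) + 𝟙 (S a ∧ S b)) A ≡⟨ total-cong A (λ a b → head-split (S a) (S b)) ⟨
    total (λ a b → 𝟙 (S b)) A                      ≡⟨ total-heads A (𝟙 ∘ S) ⟩
    sumFin (λ b → 𝟙 (S b) * inDeg A b)             ≤⟨ sum-mono (λ b → *-monoʳ-≤ (𝟙 (S b)) (in≤ P b)) ⟩
    sumFin (λ b → 𝟙 (S b) * k)                     ≡⟨ sum-*ʳ (𝟙 ∘ S) k ⟩
    count S * k                                    ≡⟨ *-comm (count S) k ⟩
    k * count S                                    ∎
  missing : sumFin (λ a → k ∸ outDeg A a) ≡ r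
  missing = +-cancelˡ-≡ (arcCount A) _ r (begin-equality
    arcCount A + sumFin (λ a → k ∸ outDeg A a)     ≡⟨ sum-+ (outDeg A) _ ⟨
    sumFin (λ a → outDeg A a + (k ∸ outDeg A a))   ≡⟨ sum-cong (λ a → m+[n∸m]≡n (out≤ P a)) ⟩
    sumFin {n} (λ _ → k)                           ≡⟨ trans (sum-const n k) (*-comm n k) ⟩
    k * n                                          ≡⟨ deficit ⟨
    arcCount A + r                                 ∎)
  tails : k * count S ≤ leaving + inside + r
  tails = begin
    k * count S                                              ≡⟨ *-comm k (count S) ⟩
    count S * k                                              ≡⟨ sum-*ʳ (𝟙 ∘ S) k ⟨
    sumFin (λ a → 𝟙 (S a) * k)                               ≤⟨ sum-mono (λ a → pointwise (S a) (out≤ P a)) ⟩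
    sumFin (λ a → 𝟙 (S a) * outDeg A a + (k ∸ outDeg A a))   ≡⟨ sum-+ (λ a → 𝟙 (S a) * outDeg A a) _ ⟩
    sumFin (λ a → 𝟙 (S a) * outDeg A a) + sumFin (λ a → k ∸ outDeg A a) ≡⟨ cong₂ _+_ (sym (total-tails A (𝟙 ∘ S))) missing ⟩
    total (λ a b → 𝟙 (S a)) A + r                            ≡⟨ cong (_+ r) (total-cong A (λ a b → tail-split (S a) (S b))) ⟩
    total (λ a b → 𝟙 (S a ∧ not (S b)) + 𝟙 (S a ∧ S b)) A + r ≡⟨ cong (_+ r) (total-+ A _ _) ⟩
    leaving + inside + r                                     ∎
    where
    pointwise : ∀ s {d} → d ≤ k → 𝟙 s * k ≤ 𝟙 s * d + (k ∸ d)
    pointwise true {d} d≤k = ≤-reflexive (trans (+-identityʳ k) (trans (sym (m+[n∸m]≡n d≤k)) (cong (_+ (k ∸ d)) (sym (+-identityʳ d)))))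
    pointwise false d≤k = z≤n
  entering≤ : entering ≤ leaving + r
  entering≤ = +-cancelʳ-≤ inside _ _ (≤-trans heads (≤-trans tails (≤-reflexive (swap leaving inside r))))
    where
    swap : ∀ x y z → x + y + z ≡ x + z + y
    swap = solve-∀

-- Heads obstructed by short walks

walkCount : ∀ {n} → Digraph n → ℕ → Fin n → Fin n → ℕ
walkCount A zero    x y = δ x y
walkCount A (suc ℓ) x y = sumFin (λ w → 𝟙 (A x w) * walkCount A ℓ w y)

walk⇒walkCount : ∀ {n} {A : Digraph n} {x y ℓ} → Walk A x y ℓ → 1 ≤ walkCount A ℓ x y
walk⇒walkCount {x = x} stay = ≤-reflexive (sym (δ-refl x))
walk⇒walkCount {A = A} {x} {y} (step {w = w} {ℓ = ℓ} e p) = begin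
  1                                  ≤⟨ walk⇒walkCount p ⟩
  walkCount A ℓ w y                  ≡⟨ +-identityʳ _ ⟨
  1 * walkCount A ℓ w y              ≡⟨ cong (λ b → 𝟙 b * walkCount A ℓ w y) e ⟨
  𝟙 (A x w) * walkCount A ℓ w y      ≤⟨ term≤sum (λ w → 𝟙 (A x w) * walkCount A ℓ w y) w ⟩
  walkCount A (suc ℓ) x y            ∎
  where open ≤-Reasoning

-- Walks are counted, although only their existence matters, because the number of walks ending in
-- `y` grows by at most the in-degree `k` per step. The bound does not depend on the number of
-- vertices.
walkCount-≤ : ∀ {n k} (A : Digraph n) → (∀ v → inDeg A v ≤ k) → ∀ ℓ y →
  sumFin (λ x → walkCount A ℓ x y) ≤ k ^ ℓ
walkCount-≤ A in≤k zero y = ≤-reflexive (sum-δ₁ y)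
walkCount-≤ {k = k} A in≤k (suc ℓ) y = begin
  total (λ _ w → walkCount A ℓ w y) A             ≡⟨ total-heads A (λ w → walkCount A ℓ w y) ⟩
  sumFin (λ w → walkCount A ℓ w y * inDeg A w)    ≤⟨ sum-mono (λ w → *-monoʳ-≤ (walkCount A ℓ w y) (in≤k w)) ⟩
  sumFin (λ w → walkCount A ℓ w y * k)            ≡⟨ sum-*ʳ (λ w → walkCount A ℓ w y) k ⟩
  sumFin (λ w → walkCount A ℓ w y) * k            ≤⟨ *-monoˡ-≤ k (walkCount-≤ A in≤k ℓ y) ⟩
  k ^ ℓ * k                                       ≡⟨ *-comm (k ^ ℓ) k ⟩
  k ^ suc ℓ                                       ∎
  where open ≤-Reasoning

-- The value 0 certifies that the arc from `u` to `v` may be added; the walk of length 0 accounts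
-- for the loop at `u`. Being a number, it can be summed over `v`, which bounds the obstructed heads
-- by `maxObstruction`: at most `k` out-neighbours and `k ^ i` starts of walks of length `i` to `u`.
obstruction : ∀ {n} → ℕ → Digraph n → Fin n → Fin n → ℕ
obstruction g A u v = 𝟙 (A u v) + sumFin {g} (λ i → walkCount A (toℕ i) v u)

unobstructed : ∀ {n g} (A : Digraph n) {u v} → obstruction g A u v ≡ 0 →
  A u v ≡ false × (∀ {ℓ} → suc ℓ < g → ¬ Walk A v u ℓ)
unobstructed {g = g} A {u} {v} none =
  ¬true⇒false (λ e → contradiction (trans (sym (cong 𝟙 e)) (m+n≡0⇒m≡0 _ none)) λ ()) ,
  λ {ℓ} lt p → <⇒≱ (walk⇒walkCount p) (≤-reflexive (no-walk (<⇒≤ lt)))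
  where
  no-walk : ∀ {ℓ} → ℓ < g → walkCount A ℓ v u ≡ 0
  no-walk ℓ<g = trans (cong (λ i → walkCount A i v u) (sym (Fin.toℕ-fromℕ< ℓ<g)))
    (sum≡0 (λ i → walkCount A (toℕ i) v u) (m+n≡0⇒n≡0 (𝟙 (A u v)) none) (fromℕ< ℓ<g))

maxObstruction : ℕ → ℕ → ℕ
maxObstruction g k = k + sumFin {g} (λ i → k ^ toℕ i)

obstruction-≤ : ∀ {n g k} {A : Digraph n} → Partial g k A → ∀ u →
  sumFin (obstruction g A u) ≤ maxObstruction g k
obstruction-≤ {g = g} {k} {A} P u = begin
  sumFin (obstruction g A u)                                      ≡⟨ sum-+ (λ v → 𝟙 (A u v)) _ ⟩
  outDeg A u + sumFin (λ v → sumFin {g} (λ i → walkCount A (toℕ i) v u))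
    ≡⟨ cong (outDeg A u +_) (sum-swap (λ v (i : Fin g) → walkCount A (toℕ i) v u)) ⟩
  outDeg A u + sumFin {g} (λ i → sumFin (λ v → walkCount A (toℕ i) v u))
    ≤⟨ +-mono-≤ (out≤ P u) (sum-mono {g} (λ i → walkCount-≤ A (in≤ P) (toℕ i) u)) ⟩
  maxObstruction g k                                              ∎
  where open ≤-Reasoning

-- The potential of a partial digraph

kept : ∀ {n} → (Fin n → Bool) → Digraph n → ℕ
kept S = total (λ a b → 𝟙 (not (S a xor S b)))

cut+kept : ∀ {n} (S : Fin n → Bool) A → cut S A + kept S A ≡ arcCount A
cut+kept S A = begin
  cut S A + kept S A                                              ≡⟨ total-+ A _ _ ⟨
  total (λ a b → 𝟙 (S a xor S b) + 𝟙 (not (S a xor S b))) A       ≡⟨ total-cong A (λ a b → complement (S a xor S b)) ⟩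
  total (λ _ _ → 1) A                                             ≡⟨ sum-cong (λ a → sum-cong (λ b → *-identityʳ (𝟙 (A a b)))) ⟩
  arcCount A                                                      ∎
  where
  open ≡-Reasoning
  complement : ∀ b → 𝟙 b + 𝟙 (not b) ≡ 1
  complement true  = refl
  complement false = refl

-- Strict only at 0, where no head is left on that side of the cut although the words counted by `Ψ`
-- may still choose it. This is the one source of inequality in `Ψ-average`.
i*[i-1]!≤i! : ∀ i → i * pred i ! ≤ i !
i*[i-1]!≤i! zero    = z≤n
i*[i-1]!≤i! (suc i) = ≤-refl

room : ∀ {n} → ℕ → Digraph n → Fin n → ℕ
room k A v = k ∸ inDeg A v

roomIn : ∀ {n} → ℕ → Digraph n → (Fin n → Bool) → ℕ
roomIn k A S = sumFin (λ v → 𝟙 (S v) * room k A v)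

sum-room : ∀ {n g k r} (A : Digraph n) → Partial g k A → arcCount A + r ≡ k * n → sumFin (room k A) ≡ r
sum-room {n} {k = k} {r} A P deficit = +-cancelˡ-≡ (arcCount A) _ r (begin
  arcCount A + sumFin (room k A)              ≡⟨ cong (_+ sumFin (room k A)) (arcCount-by-heads A) ⟩
  sumFin (inDeg A) + sumFin (room k A)        ≡⟨ sum-+ (inDeg A) _ ⟨
  sumFin (λ b → inDeg A b + (k ∸ inDeg A b))  ≡⟨ sum-cong (λ b → m+[n∸m]≡n (in≤ P b)) ⟩
  sumFin {n} (λ _ → k)                        ≡⟨ trans (sum-const n k) (*-comm n k) ⟩
  k * n                                       ≡⟨ deficit ⟨
  arcCount A + r                              ∎)
  where open ≡-Reasoning

roomIn-addArc : ∀ {n k} (A : Digraph n) {u v} → A u v ≡ false → 0 < room k A v → ∀ S →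
  roomIn k A S ≡ roomIn k (addArc A u v) S + 𝟙 (S v)
roomIn-addArc {k = k} A {u} {v} uv∉A space S = begin
  sumFin (λ b → 𝟙 (S b) * room k A b)
    ≡⟨ sum-cong (λ b → trans (cong (𝟙 (S b) *_) (room-drop b)) (expand (𝟙 (S b)) (room k A′ b) (δ b v))) ⟩
  sumFin (λ b → 𝟙 (S b) * room k A′ b + δ b v * 𝟙 (S b))
    ≡⟨ sum-+ (λ b → 𝟙 (S b) * room k A′ b) _ ⟩
  roomIn k A′ S + sumFin (λ b → δ b v * 𝟙 (S b))
    ≡⟨ cong (roomIn k A′ S +_) (sum-δ (𝟙 ∘ S) v) ⟩
  roomIn k A′ S + 𝟙 (S v) ∎
  where
  open ≡-Reasoning
  A′ = addArc A u v
  expand : ∀ x y z → x * (y + z) ≡ x * y + z * x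
  expand = solve-∀
  room-drop : ∀ b → room k A b ≡ room k A′ b + δ b v
  room-drop b = trans (drop b) (cong (λ d → k ∸ d + δ b v) (sym (inDeg-ext (addArc-ext A uv∉A) b)))
    where
    drop : ∀ b → k ∸ inDeg A b ≡ k ∸ (inDeg A b + δ b v) + δ b v
    drop b with b ≟ v
    ... | yes refl = sym (trans (cong (_+ 1) (sym (∸-+-assoc k (inDeg A b) 1))) (m∸n+n≡m space))
    ... | no _     = sym (trans (+-identityʳ _) (cong (k ∸_) (+-identityʳ (inDeg A b))))

module Potential (k c d : ℕ) where

  -- Give every arc of the cut weight c and every other arc weight d.  Summed over all ways to match the
  -- r missing tails with the free heads, the products of the weights are at most Ψ: a matching is a word
  -- telling on which side of S the heads lie (all words together contribute (c + d) ^ r) with an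
  -- ordering of the heads on either side.
  Ψ : ∀ {n} → ℕ → (Fin n → Bool) → Digraph n → ℕ
  Ψ r S A = c ^ cut S A * d ^ kept S A * (c + d) ^ r * (roomIn k A S ! * roomIn k A (not ∘ S) !)

  module _ {n} (A : Digraph n) (u : Fin n) (r : ℕ) (S : Fin n → Bool) where

    private
      i₁ i₂ : ℕ
      i₁ = roomIn k A S
      i₂ = roomIn k A (not ∘ S)

    -- The potential after an arc from u is added whose head lies in S iff the Boolean is true.
    Ψ-next : Bool → ℕ
    Ψ-next b = c ^ (cut S A + 𝟙 (S u xor b)) * d ^ (kept S A + 𝟙 (not (S u xor b))) * (c + d) ^ r
      * (if b then pred i₁ ! * i₂ ! else i₁ ! * pred i₂ !)

    Ψ-addArc : ∀ {v} → A u v ≡ false → 0 < room k A v → Ψ r S (addArc A u v) ≡ Ψ-next (S v)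
    Ψ-addArc {v} uv∉A space = cong₂ (λ x y → x * (c + d) ^ r * y)
      (cong₂ (λ x y → c ^ x * d ^ y) (total-ext (addArc-ext A uv∉A) _) (total-ext (addArc-ext A uv∉A) _))
      (factorials (S v) (roomIn-addArc A uv∉A space S) (roomIn-addArc A uv∉A space (not ∘ S)))
      where
      factorials : ∀ b {j₁ j₂} → i₁ ≡ j₁ + 𝟙 b → i₂ ≡ j₂ + 𝟙 (not b) →
        j₁ ! * j₂ ! ≡ (if b then pred i₁ ! * i₂ ! else i₁ ! * pred i₂ !)
      factorials true {j₁} {j₂} e₁ e₂ = sym (cong₂ (λ x y → x ! * y !)
        (cong pred (trans e₁ (+-comm j₁ 1))) (trans e₂ (+-identityʳ j₂)))
      factorials false {j₁} {j₂} e₁ e₂ = sym (cong₂ (λ x y → x ! * y !)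
        (trans e₁ (+-identityʳ j₁)) (cong pred (trans e₂ (+-comm j₂ 1))))

    -- The step of conditional expectations: if the head is drawn with probability proportional to
    -- its room, the choice of a side and of a head on it uses up one letter of the word and one
    -- factor of a factorial. Whichever side `u` is on, the weights for the two sides of the head
    -- are `c` and `d` in some order, which supplies the new factor `c + d`.
    Ψ-average : sumFin (λ v → room k A v * Ψ-next (S v)) ≤ Ψ (suc r) S A
    Ψ-average = begin
      sumFin (λ v → room k A v * Ψ-next (S v))
        ≡⟨ sum-cong (λ v → by-side (S v) (room k A v)) ⟩
      sumFin (λ v → 𝟙 (S v) * room k A v * Ψ-next true + 𝟙 (not (S v)) * room k A v * Ψ-next false)
        ≡⟨ sum-+ (λ v → 𝟙 (S v) * room k A v * Ψ-next true) _ ⟩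
      sumFin (λ v → 𝟙 (S v) * room k A v * Ψ-next true) + sumFin (λ v → 𝟙 (not (S v)) * room k A v * Ψ-next false)
        ≡⟨ cong₂ _+_ (sum-*ʳ (λ v → 𝟙 (S v) * room k A v) (Ψ-next true))
                     (sum-*ʳ (λ v → 𝟙 (not (S v)) * room k A v) (Ψ-next false)) ⟩
      i₁ * Ψ-next true + i₂ * Ψ-next false
        ≡⟨ cong₂ (λ x y → i₁ * (x * (c + d) ^ r * (pred i₁ ! * i₂ !)) + i₂ * (y * (c + d) ^ r * (i₁ ! * pred i₂ !)))
             (weights (S u xor true)) (weights (S u xor false)) ⟩
      i₁ * (weight (S u xor true) * base * (c + d) ^ r * (pred i₁ ! * i₂ !))
        + i₂ * (weight (S u xor false) * base * (c + d) ^ r * (i₁ ! * pred i₂ !))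
        ≡⟨ collect i₁ i₂ (weight (S u xor true)) (weight (S u xor false)) base ((c + d) ^ r) (pred i₁ !) (i₂ !) (i₁ !) (pred i₂ !) ⟩
      weight (S u xor true) * base * (c + d) ^ r * ((i₁ * pred i₁ !) * i₂ !)
        + weight (S u xor false) * base * (c + d) ^ r * (i₁ ! * (i₂ * pred i₂ !))
        ≤⟨ +-mono-≤
             (*-monoʳ-≤ (weight (S u xor true) * base * (c + d) ^ r) (*-monoˡ-≤ (i₂ !) (i*[i-1]!≤i! i₁)))
             (*-monoʳ-≤ (weight (S u xor false) * base * (c + d) ^ r) (*-monoʳ-≤ (i₁ !) (i*[i-1]!≤i! i₂))) ⟩
      weight (S u xor true) * base * (c + d) ^ r * (i₁ ! * i₂ !)
        + weight (S u xor false) * base * (c + d) ^ r * (i₁ ! * i₂ !)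
        ≡⟨ factor (weight (S u xor true)) (weight (S u xor false)) base ((c + d) ^ r) (i₁ ! * i₂ !) ⟩
      base * ((weight (S u xor true) + weight (S u xor false)) * (c + d) ^ r) * (i₁ ! * i₂ !)
        ≡⟨ cong (λ s → base * (s * (c + d) ^ r) * (i₁ ! * i₂ !)) (both-weights (S u)) ⟩
      Ψ (suc r) S A ∎
      where
      open ≤-Reasoning
      base = c ^ cut S A * d ^ kept S A
      weight : Bool → ℕ
      weight b = if b then c else d
      by-side : ∀ b x → x * Ψ-next b ≡ 𝟙 b * x * Ψ-next true + 𝟙 (not b) * x * Ψ-next false
      by-side true  x = sym (trans (+-identityʳ _) (cong (_* Ψ-next true) (+-identityʳ x)))
      by-side false x = sym (cong (_* Ψ-next false) (+-identityʳ x))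
      both-weights : ∀ b → weight (b xor true) + weight (b xor false) ≡ c + d
      both-weights true  = +-comm d c
      both-weights false = refl
      weights : ∀ b → c ^ (cut S A + 𝟙 b) * d ^ (kept S A + 𝟙 (not b)) ≡ weight b * base
      weights true rewrite +-comm (cut S A) 1 | +-identityʳ (kept S A) = *-assoc c _ _
      weights false rewrite +-comm (kept S A) 1 | +-identityʳ (cut S A) = swap (c ^ cut S A) d _
        where
        swap : ∀ x y z → x * (y * z) ≡ y * (x * z)
        swap = solve-∀
      collect : ∀ i₁ i₂ w₁ w₂ b e p₁ f₂ f₁ p₂ →
        i₁ * (w₁ * b * e * (p₁ * f₂)) + i₂ * (w₂ * b * e * (f₁ * p₂))
          ≡ w₁ * b * e * ((i₁ * p₁) * f₂) + w₂ * b * e * (f₁ * (i₂ * p₂))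
      collect = solve-∀
      factor : ∀ w₁ w₂ b e f → w₁ * b * e * f + w₂ * b * e * f ≡ b * ((w₁ + w₂) * e) * f
      factor = solve-∀

  -- Numbering the vertex sets by `Fin (2 ^ n)` lets `sumFin` range over them. An arbitrary `S`
  -- agrees with a numbered one pointwise, hence the congruence lemma for cuts in `greedy`.
  side : ∀ {n} → Fin (2 ^ n) → Fin n → Bool
  side {n} i v = ⌊ finToFun {2} {n} i v ≟ zero ⌋

  balanced : ∀ {n} → ℕ → Fin (2 ^ n) → Bool
  balanced {n} h i = count (side {n} i) ≡ᵇ h

  potential : ∀ {n} → ℕ → ℕ → Digraph n → ℕ
  potential {n} h r A = sumFin (λ i → 𝟙 (balanced {n} h i) * Ψ r (side {n} i) A)

  potential-next : ∀ {n} → ℕ → Digraph n → Fin n → ℕ → Fin n → ℕ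
  potential-next {n} h A u r v = sumFin (λ i → 𝟙 (balanced {n} h i) * Ψ-next A u r (side {n} i) (side {n} i v))

  potential-addArc : ∀ {n} h (A : Digraph n) {u v} r → A u v ≡ false → 0 < room k A v →
    potential h r (addArc A u v) ≡ potential-next h A u r v
  potential-addArc {n} h A {u} {v} r uv∉A space =
    sum-cong (λ i → cong (𝟙 (balanced {n} h i) *_) (Ψ-addArc A u r (side {n} i) uv∉A space))

  potential-average : ∀ {n} h (A : Digraph n) u r →
    sumFin (λ v → room k A v * potential-next h A u r v) ≤ potential h (suc r) A
  potential-average {n} h A u r = begin
    sumFin (λ v → room k A v * sumFin (λ i → β i * next i v))
      ≡⟨ sum-cong (λ v → trans (sym (sum-*ˡ (room k A v) (λ i → β i * next i v)))
           (sum-cong (λ i → swap (room k A v) (β i) (next i v)))) ⟩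
    sumFin (λ v → sumFin (λ i → β i * (room k A v * next i v)))
      ≡⟨ sum-swap (λ v i → β i * (room k A v * next i v)) ⟩
    sumFin (λ i → sumFin (λ v → β i * (room k A v * next i v)))
      ≡⟨ sum-cong (λ i → sum-*ˡ (β i) (λ v → room k A v * next i v)) ⟩
    sumFin (λ i → β i * sumFin (λ v → room k A v * next i v))
      ≤⟨ sum-mono (λ i → *-monoʳ-≤ (β i) (Ψ-average A u r (side {n} i))) ⟩
    potential h (suc r) A ∎
    where
    open ≤-Reasoning
    β : Fin (2 ^ n) → ℕ
    β i = 𝟙 (balanced {n} h i)
    next : Fin (2 ^ n) → Fin n → ℕ
    next i v = Ψ-next A u r (side {n} i) (side {n} i v)
    swap : ∀ x y z → x * (y * z) ≡ y * (x * z)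
    swap = solve-∀

  -- Of the total room K + suc j, the obstructed heads hold at most K, so the admissible ones keep
  -- at least suc j. Averaging over these alone divides the potential by suc j in place of K + suc
  -- j; over the whole run these losses amount to the polynomial factor of `falling-factorial`.
  greedy-step : ∀ {n g} h j (A : Digraph n) → Partial g k A →
    arcCount A + (k * maxObstruction g k + suc j) ≡ k * n →
    ∃[ A′ ] Partial {n} g k A′ × arcCount A′ + (k * maxObstruction g k + j) ≡ k * n ×
      suc j * potential h (k * maxObstruction g k + j) A′ ≤ potential h (k * maxObstruction g k + suc j) A
  greedy-step {n} {g} h j A P deficit = A′ ,
    addArc-partial A P (proj₁ free) (proj₂ uᵈ) (m∸n≢0⇒n<m (>⇒≢ space)) (proj₂ free) ,
    trans (cong (_+ (K + j)) (arcCount-ext (addArc-ext A (proj₁ free)))) (trans (sym (+-suc (arcCount A) (K + j))) deficit′) ,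
    (begin
      suc j * potential h (K + j) A′         ≡⟨ cong (suc j *_) (potential-addArc h A (K + j) (proj₁ free) space) ⟩
      suc j * q v                            ≤⟨ *-monoˡ-≤ (q v) w-large ⟩
      sumFin w * q v                         ≤⟨ proj₂ (proj₂ vᵈ) ⟩
      sumFin (λ v → w v * q v)               ≤⟨ sum-mono (λ v → *-monoˡ-≤ (q v) (w≤room v)) ⟩
      sumFin (λ v → room k A v * q v)        ≤⟨ potential-average h A u (K + j) ⟩
      potential h (suc (K + j)) A            ≡⟨ cong (λ r → potential h r A) (+-suc K j) ⟨
      potential h (K + suc j) A              ∎)
    where
    open ≤-Reasoning
    K = k * maxObstruction g k
    deficit′ : arcCount A + suc (K + j) ≡ k * n
    deficit′ = trans (cong (arcCount A +_) (sym (+-suc K j))) deficit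
    uᵈ : ∃[ u ] outDeg A u < k
    uᵈ = ∃-below-constant k (outDeg A)
      (subst (suc (arcCount A) ≤_) (trans (sym (+-suc _ _)) deficit′) (s≤s (m≤m+n _ _)))
    u = proj₁ uᵈ
    obs : Fin n → ℕ
    obs = obstruction g A u
    w : Fin n → ℕ
    w v = room k A v * 𝟙 (obs v ≡ᵇ 0)
    q : Fin n → ℕ
    q = potential-next h A u (K + j)
    w≤room : ∀ v → w v ≤ room k A v
    w≤room v = ≤-trans (*-monoʳ-≤ (room k A v) (𝟙≤1 (obs v ≡ᵇ 0))) (≤-reflexive (*-identityʳ _))
    room≤ : ∀ v → room k A v ≤ w v + k * obs v
    room≤ v with obs v
    ... | zero  = ≤-trans (≤-reflexive (sym (*-identityʳ _))) (m≤m+n _ _)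
    ... | suc o = ≤-trans (m∸n≤m k (inDeg A v)) (≤-trans (m≤m*n k (suc o)) (m≤n+m _ _))
    w-large : suc j ≤ sumFin w
    w-large = +-cancelʳ-≤ K (suc j) (sumFin w) (begin
      suc j + K                                  ≡⟨ +-comm (suc j) K ⟩
      K + suc j                                  ≡⟨ sum-room A P deficit ⟨
      sumFin (room k A)                          ≤⟨ sum-mono room≤ ⟩
      sumFin (λ v → w v + k * obs v)             ≡⟨ trans (sum-+ w _) (cong (sumFin w +_) (sum-*ˡ k obs)) ⟩
      sumFin w + k * sumFin obs                  ≤⟨ +-monoʳ-≤ (sumFin w) (*-monoʳ-≤ k (obstruction-≤ P u)) ⟩
      sumFin w + K                               ∎)
    vᵈ : ∃[ v ] 0 < w v × sumFin w * q v ≤ sumFin (λ v → w v * q v)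
    vᵈ = ∃-below-average w q (≤-trans (s≤s z≤n) w-large)
    v = proj₁ vᵈ
    space : 0 < room k A v
    space = ≤-trans (proj₁ (proj₂ vᵈ)) (w≤room v)
    obs≡0 : ∀ o x → 0 < x * 𝟙 (o ≡ᵇ 0) → o ≡ 0
    obs≡0 zero    x pos = refl
    obs≡0 (suc o) x pos = contradiction (subst (0 <_) (*-zeroʳ x) pos) (<-irrefl refl)
    free : A u v ≡ false × (∀ {ℓ} → suc ℓ < g → ¬ Walk A v u ℓ)
    free = unobstructed A (obs≡0 (obs v) (room k A v) (proj₁ (proj₂ vᵈ)))
    A′ = addArc A u v

  greedy-steps : ∀ {n g} h j (A : Digraph n) → Partial g k A →
    arcCount A + (k * maxObstruction g k + j) ≡ k * n →
    ∃[ A′ ] Partial {n} g k A′ × arcCount A′ + k * maxObstruction g k ≡ k * n ×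
      j ! * potential h (k * maxObstruction g k) A′ ≤ potential h (k * maxObstruction g k + j) A
  greedy-steps {g = g} h zero A P deficit = A , P ,
    trans (cong (arcCount A +_) (sym (+-identityʳ _))) deficit ,
    ≤-reflexive (trans (+-identityʳ _) (cong (λ r → potential h r A) (sym (+-identityʳ (k * maxObstruction g k)))))
  greedy-steps {g = g} h (suc j) A P deficit =
    let (A₁ , P₁ , deficit₁ , drop₁) = greedy-step h j A P deficit
        (A₂ , P₂ , deficit₂ , drop₂) = greedy-steps h j A₁ P₁ deficit₁
        K = k * maxObstruction g k
    in A₂ , P₂ , deficit₂ ,
      ≤-trans (≤-reflexive (*-assoc (suc j) (j !) (potential h K A₂))) (≤-trans (*-monoʳ-≤ (suc j) drop₂) drop₁)

  noArcs : ∀ {n} → Digraph n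
  noArcs _ _ = false

  noArcs-partial : ∀ {n g} → Partial {n} g k noArcs
  noArcs-partial {n} = record
    { out≤ = λ _ → ≤-trans (≤-reflexive (sum-zero n)) z≤n
    ; in≤ = λ _ → ≤-trans (≤-reflexive (sum-zero n)) z≤n
    ; noShort = λ { _ (step () _) }
    }

  total-noArcs : ∀ {n} f → total f (noArcs {n}) ≡ 0
  total-noArcs {n} f = trans (sum-cong {n} (λ _ → sum-zero n)) (sum-zero n)

  roomIn-noArcs : ∀ {n} (S : Fin n → Bool) → roomIn k noArcs S ≡ k * count S
  roomIn-noArcs {n} S = trans (sum-cong (λ v → cong (λ d → 𝟙 (S v) * (k ∸ d)) (sum-zero n)))
    (trans (sum-*ʳ (𝟙 ∘ S) k) (*-comm (count S) k))

  count-complement : ∀ {n} (S : Fin n → Bool) → count S + count (not ∘ S) ≡ n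
  count-complement {n} S = trans (sym (sum-+ (𝟙 ∘ S) _))
    (trans (sum-cong (λ v → one (S v))) (trans (sum-const n 1) (*-identityʳ n)))
    where
    one : ∀ b → 𝟙 b + 𝟙 (not b) ≡ 1
    one true  = refl
    one false = refl

  potential-noArcs : ∀ h r → potential {2 * h} h r noArcs ≤ 2 ^ (2 * h) * ((c + d) ^ r * ((k * h) ! * (k * h) !))
  potential-noArcs h r = ≤-trans (sum-mono bound) (≤-reflexive (sum-const (2 ^ (2 * h)) _))
    where
    X = (c + d) ^ r * ((k * h) ! * (k * h) !)
    Ψ≡ : ∀ (S : Fin (2 * h) → Bool) → count S ≡ h → Ψ r S noArcs ≡ X
    Ψ≡ S half = trans
      (cong₂ (λ x y → x * (c + d) ^ r * y)
        (cong₂ (λ x y → c ^ x * d ^ y)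
          (total-noArcs {2 * h} (λ a b → 𝟙 (S a xor S b))) (total-noArcs {2 * h} (λ a b → 𝟙 (not (S a xor S b)))))
        (cong₂ (λ x y → x ! * y !)
          (trans (roomIn-noArcs S) (cong (k *_) half)) (trans (roomIn-noArcs (not ∘ S)) (cong (k *_) half′))))
      (cong (_* ((k * h) ! * (k * h) !)) (+-identityʳ ((c + d) ^ r)))
      where
      half′ : count (not ∘ S) ≡ h
      half′ = +-cancelˡ-≡ h (count (not ∘ S)) h (trans (cong (_+ count (not ∘ S)) (sym half))
        (trans (count-complement S) (cong (h +_) (+-identityʳ h))))
    weighted : ∀ b {x} → (T b → x ≡ X) → 𝟙 b * x ≤ X
    weighted false e = z≤n
    weighted true  e = ≤-reflexive (trans (+-identityʳ _) (e tt))
    bound : ∀ i → 𝟙 (balanced {2 * h} h i) * Ψ r (side {2 * h} i) noArcs ≤ X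
    bound i = weighted (balanced {2 * h} h i) (λ t → Ψ≡ (side {2 * h} i) (≡ᵇ⇒≡ _ h t))

  side-surjective : ∀ {n} (S : Fin n → Bool) → ∃[ i ] (∀ v → side {n} i v ≡ S v)
  side-surjective {n} S = funToFin f , λ v →
    trans (cong (λ x → ⌊ x ≟ zero ⌋) (Fin.finToFun-funToFin f v)) (decode (S v))
    where
    encode : Bool → Fin 2
    encode b = if b then zero else suc zero
    f : Fin n → Fin 2
    f = encode ∘ S
    decode : ∀ b → ⌊ encode b ≟ zero ⌋ ≡ b
    decode true  = refl
    decode false = refl

  -- Each balanced set is a single term of the final potential and so is bounded by the initial one.
  -- The `k * maxObstruction g k` missing arcs are counted as if they were not in the cut, by d ≤ c
  -- + d, so that the two exponents add up to the full number of arcs.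
  greedy : ∀ g h → k * maxObstruction g k ≤ k * (2 * h) →
    ∃[ A ] Partial {2 * h} g k A × arcCount A + k * maxObstruction g k ≡ k * (2 * h) ×
      (∀ S → count S ≡ h →
        (k * (2 * h) ∸ k * maxObstruction g k) ! * (c ^ cut S A * d ^ (k * (2 * h) ∸ cut S A))
          ≤ 2 ^ (2 * h) * ((c + d) ^ (k * (2 * h)) * ((k * h) ! * (k * h) !)))
  greedy g h K≤ = A , proj₁ (proj₂ run) , deficit , bound
    where
    open ≤-Reasoning
    K = k * maxObstruction g k
    j = k * (2 * h) ∸ K
    empty : arcCount (noArcs {2 * h}) + (K + j) ≡ k * (2 * h)
    empty = trans (cong (_+ (K + j)) (trans (sum-cong {2 * h} (λ _ → sum-zero (2 * h))) (sum-zero (2 * h)))) (m+[n∸m]≡n K≤)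
    run = greedy-steps {2 * h} {g} h j noArcs noArcs-partial empty
    A : Digraph (2 * h)
    A = proj₁ run
    deficit : arcCount A + K ≡ k * (2 * h)
    deficit = proj₁ (proj₂ (proj₂ run))
    drop : j ! * potential h K A ≤ potential {2 * h} h (K + j) noArcs
    drop = proj₂ (proj₂ (proj₂ run))
    Ψ≥ : ∀ S → c ^ cut S A * d ^ (k * (2 * h) ∸ cut S A) ≤ Ψ K S A
    Ψ≥ S = begin
      c ^ cut S A * d ^ (k * (2 * h) ∸ cut S A)     ≡⟨ cong (λ e → c ^ cut S A * d ^ e) exponent ⟩
      c ^ cut S A * d ^ (kept S A + K)              ≡⟨ cong (c ^ cut S A *_) (^-distribˡ-+-* d (kept S A) K) ⟩
      c ^ cut S A * (d ^ kept S A * d ^ K)          ≡⟨ *-assoc (c ^ cut S A) _ _ ⟨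
      c ^ cut S A * d ^ kept S A * d ^ K            ≤⟨ *-monoʳ-≤ (c ^ cut S A * d ^ kept S A) (^-monoˡ-≤ K (m≤n+m d c)) ⟩
      c ^ cut S A * d ^ kept S A * (c + d) ^ K      ≤⟨ m≤m*n _ (roomIn k A S ! * roomIn k A (not ∘ S) !)
        {{>-nonZero (*-mono-≤ (1≤n! (roomIn k A S)) (1≤n! (roomIn k A (not ∘ S))))}} ⟩
      Ψ K S A                                       ∎
      where
      exponent : k * (2 * h) ∸ cut S A ≡ kept S A + K
      exponent = trans (cong (_∸ cut S A) (trans (sym deficit) (trans (cong (_+ K) (sym (cut+kept S A))) (+-assoc (cut S A) _ K))))
        (m+n∸m≡n (cut S A) _)
    cut-cong : ∀ {S S′ : Fin (2 * h) → Bool} → (∀ v → S v ≡ S′ v) → cut S A ≡ cut S′ A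
    cut-cong S≡S′ = total-cong A (λ a b → cong₂ (λ x y → 𝟙 (x xor y)) (S≡S′ a) (S≡S′ b))
    bound : ∀ S → count S ≡ h → j ! * (c ^ cut S A * d ^ (k * (2 * h) ∸ cut S A))
      ≤ 2 ^ (2 * h) * ((c + d) ^ (k * (2 * h)) * ((k * h) ! * (k * h) !))
    bound S half = begin
      j ! * (c ^ cut S A * d ^ (k * (2 * h) ∸ cut S A))
        ≡⟨ cong (λ x → j ! * (c ^ x * d ^ (k * (2 * h) ∸ x))) (cut-cong i≡S) ⟨
      j ! * (c ^ cut Sᵢ A * d ^ (k * (2 * h) ∸ cut Sᵢ A))          ≤⟨ *-monoʳ-≤ (j !) (Ψ≥ Sᵢ) ⟩
      j ! * Ψ K Sᵢ A                                               ≡⟨ cong (j ! *_) (sym (+-identityʳ _)) ⟩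
      j ! * (1 * Ψ K Sᵢ A)                                         ≡⟨ cong (λ b → j ! * (𝟙 b * Ψ K Sᵢ A)) is-balanced ⟨
      j ! * (𝟙 (balanced {2 * h} h i) * Ψ K Sᵢ A)                  ≤⟨ *-monoʳ-≤ (j !) (term≤sum (λ i → 𝟙 (balanced {2 * h} h i) * Ψ K (side {2 * h} i) A) i) ⟩
      j ! * potential h K A                                        ≤⟨ drop ⟩
      potential {2 * h} h (K + j) noArcs                           ≡⟨ cong (λ r → potential {2 * h} h r noArcs) (m+[n∸m]≡n K≤) ⟩
      potential {2 * h} h (k * (2 * h)) noArcs                     ≤⟨ potential-noArcs h (k * (2 * h)) ⟩
      2 ^ (2 * h) * ((c + d) ^ (k * (2 * h)) * ((k * h) ! * (k * h) !)) ∎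
      where
      i = proj₁ (side-surjective S)
      i≡S = proj₂ (side-surjective S)
      Sᵢ = side {2 * h} i
      T⇒true : ∀ {b} → T b → b ≡ true
      T⇒true {true} _ = refl
      is-balanced : balanced {2 * h} h i ≡ true
      is-balanced = T⇒true (≡⇒≡ᵇ (count Sᵢ) h (trans (sum-cong (λ v → cong 𝟙 (i≡S v))) half))

-- Powers and factorials

-- Bernoulli's (1 + x / q)^n ≥ 1 + n x / q, multiplied by q^(n + 1).
bernoulli : ∀ q x n → q ^ n * (q + n * x) ≤ q * (q + x) ^ n
bernoulli q x zero    = ≤-reflexive (trans (+-identityʳ _) (trans (+-identityʳ q) (sym (*-identityʳ q))))
bernoulli q x (suc n) = begin
  q * q ^ n * (q + (x + n * x))                         ≤⟨ m≤m+n _ (x * n * x * q ^ n) ⟩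
  q * q ^ n * (q + (x + n * x)) + x * n * x * q ^ n     ≡⟨ regroup q x n (q ^ n) ⟩
  (q + x) * (q ^ n * (q + n * x))                       ≤⟨ *-monoʳ-≤ (q + x) (bernoulli q x n) ⟩
  (q + x) * (q * (q + x) ^ n)                           ≡⟨ swap (q + x) q _ ⟩
  q * (q + x) ^ suc n                                   ∎
  where
  open ≤-Reasoning
  regroup : ∀ q x n y → q * y * (q + (x + n * x)) + x * n * x * y ≡ (q + x) * (y * (q + n * x))
  regroup = solve-∀
  swap : ∀ x y z → x * (y * z) ≡ y * (x * z)
  swap = solve-∀

-- Bernoulli's inequality for 1 - x / (q + x), multiplied by (q + x)^(n + 1) and with the negative
-- term moved to the other side.
bernoulli⁻ : ∀ q x n → (q + x) ^ n * (q + x) ≤ q ^ n * (q + x) + n * x * (q + x) ^ n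
bernoulli⁻ q x zero    = m≤m+n _ 0
bernoulli⁻ q x (suc n) = begin
  p * p ^ n * p                                   ≡⟨ *-assoc p (p ^ n) p ⟩
  p * (p ^ n * p)                                 ≤⟨ *-monoʳ-≤ p (bernoulli⁻ q x n) ⟩
  p * (q ^ n * p + n * x * p ^ n)                 ≡⟨ regroup q x n (q ^ n) (p ^ n) ⟩
  q * q ^ n * p + x * (q ^ n * p) + n * x * (p * p ^ n)
    ≤⟨ +-monoˡ-≤ _ (+-monoʳ-≤ (q * q ^ n * p) (*-monoʳ-≤ x (*-monoˡ-≤ p (^-monoˡ-≤ n (m≤m+n q x))))) ⟩
  q * q ^ n * p + x * (p ^ n * p) + n * x * (p * p ^ n)
    ≡⟨ collect (q * q ^ n * p) x n p (p ^ n) ⟩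
  q * q ^ n * p + suc n * x * (p * p ^ n)         ∎
  where
  open ≤-Reasoning
  p = q + x
  regroup : ∀ q x n y z → (q + x) * (y * (q + x) + n * x * z)
    ≡ q * y * (q + x) + x * (y * (q + x)) + n * x * ((q + x) * z)
  regroup = solve-∀
  collect : ∀ s x n p z → s + x * (z * p) + n * x * (p * z) ≡ s + suc n * x * (p * z)
  collect = solve-∀

^-distribʳ-* : ∀ m n o → (m * n) ^ o ≡ m ^ o * n ^ o
^-distribʳ-* m n zero    = refl
^-distribʳ-* m n (suc o) rewrite ^-distribʳ-* m n o = regroup m n (m ^ o) (n ^ o)
  where
  regroup : ∀ m n x y → m * n * (x * y) ≡ m * x * (n * y)
  regroup = solve-∀

1≤^ : ∀ {m} n → 1 ≤ m → 1 ≤ m ^ n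
1≤^ {m} n 1≤m = subst (_≤ m ^ n) (^-zeroˡ n) (^-monoˡ-≤ n 1≤m)

*-cancelˡ-≤′ : ∀ {m n o} → 1 ≤ o → o * m ≤ o * n → m ≤ n
*-cancelˡ-≤′ {o = suc o} _ = *-cancelˡ-≤ (suc o)

*-cancelˡ-<′ : ∀ {m n} o → o * m < o * n → m < n
*-cancelˡ-<′ {m} {n} o = *-cancelˡ-< o m n

-- Taking n = t (E + 1) reduces the claim to Bernoulli's (1 + 1/α)^t ≥ 1 + t/α, raised to the power E + 1.
exponential-beats-polynomial : ∀ {α β} C E N → 1 ≤ α → α < β →
  ∃[ n ] N ≤ n × (C * n) ^ E * α ^ n < β ^ n
exponential-beats-polynomial {α} {β} C E N 1≤α α<β =
  n , ≤-trans (m≤n+m N _) (m≤m*n t E′) , *-cancelˡ-<′ (α ^ E′) (begin-strict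
    α ^ E′ * ((C * n) ^ E * α ^ n)
      ≡⟨ cong (λ x → α ^ E′ * (x * α ^ n)) (trans (cong (_^ E) (regroup C t E′)) (^-distribʳ-* (C * E′) t E)) ⟩
    α ^ E′ * ((C * E′) ^ E * t ^ E * α ^ n)
      ≡⟨ assoc (α ^ E′) ((C * E′) ^ E) (t ^ E) (α ^ n) ⟩
    α ^ E′ * (C * E′) ^ E * (t ^ E * α ^ n)
      <⟨ *-monoˡ-< (t ^ E * α ^ n) {{>-nonZero (*-mono-≤ (1≤^ E (s≤s z≤n)) (1≤^ n 1≤α))}} (s≤s (m≤m+n (α ^ E′ * (C * E′) ^ E) N)) ⟩
    t * (t ^ E * α ^ n)
      ≡⟨ *-assoc t (t ^ E) (α ^ n) ⟨
    t ^ E′ * α ^ n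
      ≤⟨ *-monoˡ-≤ (α ^ n) (^-monoˡ-≤ E′ (≤-trans (≤-reflexive (sym (*-identityʳ t))) (m≤n+m (t * 1) α))) ⟩
    (α + t * 1) ^ E′ * α ^ n
      ≡⟨ trans (*-comm _ (α ^ n)) (cong (_* (α + t * 1) ^ E′) (sym (^-*-assoc α t E′))) ⟩
    (α ^ t) ^ E′ * (α + t * 1) ^ E′
      ≡⟨ ^-distribʳ-* (α ^ t) (α + t * 1) E′ ⟨
    (α ^ t * (α + t * 1)) ^ E′
      ≤⟨ ^-monoˡ-≤ E′ (bernoulli α 1 t) ⟩
    (α * (α + 1) ^ t) ^ E′
      ≡⟨ trans (^-distribʳ-* α _ E′) (cong (α ^ E′ *_) (^-*-assoc (α + 1) t E′)) ⟩
    α ^ E′ * (α + 1) ^ n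
      ≤⟨ *-monoʳ-≤ (α ^ E′) (^-monoˡ-≤ n (subst (_≤ β) (+-comm 1 α) α<β)) ⟩
    α ^ E′ * β ^ n ∎)
  where
  open ≤-Reasoning
  E′ = suc E
  t = suc (α ^ E′ * (C * E′) ^ E + N)
  n = t * E′
  regroup : ∀ C t e → C * (t * e) ≡ (C * e) * t
  regroup = solve-∀
  assoc : ∀ x y z w → x * (y * z * w) ≡ x * y * (z * w)
  assoc = solve-∀

-- A lower bound for the binomial coefficient of 2m over m. In the induction step 4 (m + 1)² is
-- compared with (2m + 2) (2m + 3), which exceeds it by 2 (m + 1).
central-binomial : ∀ m → 4 ^ m * (m ! * m !) ≤ suc (2 * m) * (2 * m) !
central-binomial zero    = ≤-refl
central-binomial (suc m) = begin
  4 * 4 ^ m * (suc m * m ! * (suc m * m !))            ≡⟨ regroup m (4 ^ m) (m !) ⟩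
  4 * (suc m * suc m) * (4 ^ m * (m ! * m !))          ≤⟨ *-monoʳ-≤ (4 * (suc m * suc m)) (central-binomial m) ⟩
  4 * (suc m * suc m) * (suc (2 * m) * (2 * m) !)      ≤⟨ *-monoˡ-≤ (suc (2 * m) * (2 * m) !) (m≤m+n (4 * (suc m * suc m)) (2 * suc m)) ⟩
  (4 * (suc m * suc m) + 2 * suc m) * (suc (2 * m) * (2 * m) !) ≡⟨ collect m ((2 * m) !) ⟩
  suc (2 + 2 * m) * (2 + 2 * m) !                      ≡⟨ cong (λ x → suc x * x !) (*-suc 2 m) ⟨
  suc (2 * suc m) * (2 * suc m) !                      ∎
  where
  open ≤-Reasoning
  regroup : ∀ m p f → 4 * p * (suc m * f * (suc m * f)) ≡ 4 * (suc m * suc m) * (p * (f * f))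
  regroup = solve-∀
  collect : ∀ m f → (4 * (suc m * suc m) + 2 * suc m) * (suc (2 * m) * f)
    ≡ suc (2 + 2 * m) * ((2 + 2 * m) * (suc (2 * m) * f))
  collect = solve-∀

falling-factorial : ∀ K j → (K + j) ! ≤ (K + j) ^ K * j !
falling-factorial zero    j = m≤m+n _ 0
falling-factorial (suc K) j = begin
  suc (K + j) * (K + j) !                       ≤⟨ *-monoʳ-≤ (suc (K + j)) (falling-factorial K j) ⟩
  suc (K + j) * ((K + j) ^ K * j !)             ≤⟨ *-monoʳ-≤ (suc (K + j)) (*-monoˡ-≤ (j !) (^-monoˡ-≤ K (n≤1+n (K + j)))) ⟩
  suc (K + j) * (suc (K + j) ^ K * j !)         ≡⟨ *-assoc (suc (K + j)) (suc (K + j) ^ K) (j !) ⟨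
  suc (K + j) ^ suc K * j !                     ∎
  where open ≤-Reasoning

-- Numerical parameters

-- Balanced cuts will contain at least a proportion (k − a / b) / 2k of the arcs, where a / b < √(2k − 1);
-- c and d are the weights of the potential, and decay is the first moment bound per vertex.
record Parameters (k : ℕ) : Set where
  field
    a b c d e : ℕ
    e+a≡kb    : e + a ≡ k * b
    b>0       : 1 ≤ b
    c>0       : 1 ≤ c
    c≤d       : c ≤ d
    slope     : suc (a * a) + b * b ≤ 2 * k * (b * b)
    decay     : 4 ^ b * (c + d) ^ (2 * (k * b)) < 4 ^ (k * b) * (c ^ e * d ^ (k * b + a))

-- The sequence (1 + 2 / j)^j increases (to e²). With q = j (j + 3), consecutive terms compare
-- through (1 + 2 / q)^j, which `bernoulli⁻` estimates well enough: a constant 4 is left over.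
ratio-increasing : ∀ j → (2 + j) ^ j * suc j ^ suc j ≤ (3 + j) ^ suc j * j ^ j
ratio-increasing j = begin
  (2 + j) ^ j * (suc j * suc j ^ j)         ≡⟨ swap ((2 + j) ^ j) (suc j) _ ⟩
  suc j * ((2 + j) ^ j * suc j ^ j)         ≡⟨ cong (suc j *_) (trans (sym (^-distribʳ-* (2 + j) (suc j) j)) (cong (_^ j) (product₁ j))) ⟩
  suc j * (q + 2) ^ j                       ≤⟨ *-cancelˡ-≤ (2 + j * suc j) scaled ⟩
  (3 + j) * q ^ j                           ≡⟨ cong ((3 + j) *_) (^-distribʳ-* (3 + j) j j) ⟩
  (3 + j) * ((3 + j) ^ j * j ^ j)           ≡⟨ *-assoc (3 + j) ((3 + j) ^ j) (j ^ j) ⟨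
  (3 + j) ^ suc j * j ^ j                   ∎
  where
  open ≤-Reasoning
  q = (3 + j) * j
  swap : ∀ x y z → x * (y * z) ≡ y * (x * z)
  swap = solve-∀
  product₁ : ∀ j → (2 + j) * suc j ≡ (3 + j) * j + 2
  product₁ = solve-∀
  split : ∀ j p → p * ((3 + j) * j + 2) ≡ (2 + j * suc j) * p + j * 2 * p
  split = solve-∀
  expand : ∀ j → (2 + j * suc j) * (3 + j) ≡ suc j * ((3 + j) * j + 2) + 4
  expand = solve-∀
  bernoulli-bound : (2 + j * suc j) * (q + 2) ^ j ≤ q ^ j * (q + 2)
  bernoulli-bound = +-cancelʳ-≤ (j * 2 * (q + 2) ^ j) _ _
    (≤-trans (≤-reflexive (sym (split j ((q + 2) ^ j)))) (bernoulli⁻ q 2 j))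
  scaled : (2 + j * suc j) * (suc j * (q + 2) ^ j) ≤ (2 + j * suc j) * ((3 + j) * q ^ j)
  scaled = begin
    (2 + j * suc j) * (suc j * (q + 2) ^ j)     ≡⟨ swap (2 + j * suc j) (suc j) ((q + 2) ^ j) ⟩
    suc j * ((2 + j * suc j) * (q + 2) ^ j)     ≤⟨ *-monoʳ-≤ (suc j) bernoulli-bound ⟩
    suc j * (q ^ j * (q + 2))                   ≡⟨ trans (cong (suc j *_) (*-comm (q ^ j) (q + 2))) (sym (*-assoc (suc j) (q + 2) (q ^ j))) ⟩
    suc j * (q + 2) * q ^ j                     ≤⟨ *-monoˡ-≤ (q ^ j) (m≤m+n (suc j * (q + 2)) 4) ⟩
    (suc j * (q + 2) + 4) * q ^ j               ≡⟨ cong (_* q ^ j) (expand j) ⟨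
    (2 + j * suc j) * (3 + j) * q ^ j           ≡⟨ *-assoc (2 + j * suc j) (3 + j) (q ^ j) ⟩
    (2 + j * suc j) * ((3 + j) * q ^ j)         ∎

-- The companion sequence (1 + 2 / i)^(i + 2) decreases (to e²); `bernoulli` suffices, again with 4
-- to spare.
ratio-decreasing : ∀ i → (3 + i) ^ (3 + i) * i ^ (2 + i) ≤ suc i ^ (3 + i) * (2 + i) ^ (2 + i)
ratio-decreasing i = begin
  (3 + i) * (3 + i) ^ n * i ^ n             ≡⟨ trans (*-assoc (3 + i) ((3 + i) ^ n) (i ^ n)) (cong ((3 + i) *_) (sym (^-distribʳ-* (3 + i) i n))) ⟩
  (3 + i) * q ^ n                           ≤⟨ *-cancelˡ-≤ (4 + 5 * i + i * i) scaled ⟩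
  suc i * (q + 2) ^ n                       ≡⟨ cong (λ x → suc i * x ^ n) (product₁ i) ⟨
  suc i * (suc i * (2 + i)) ^ n             ≡⟨ cong (suc i *_) (^-distribʳ-* (suc i) (2 + i) n) ⟩
  suc i * (suc i ^ n * (2 + i) ^ n)         ≡⟨ *-assoc (suc i) (suc i ^ n) _ ⟨
  suc i ^ (3 + i) * (2 + i) ^ n             ∎
  where
  open ≤-Reasoning
  n = 2 + i
  q = (3 + i) * i
  product₁ : ∀ i → suc i * (2 + i) ≡ (3 + i) * i + 2
  product₁ = solve-∀
  slope-eq : ∀ i → (3 + i) * i + (2 + i) * 2 ≡ 4 + 5 * i + i * i
  slope-eq = solve-∀
  expand : ∀ i → (3 + i) * ((3 + i) * i) + 4 ≡ (4 + 5 * i + i * i) * suc i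
  expand = solve-∀
  swap : ∀ x y z → x * (y * z) ≡ y * (z * x)
  swap = solve-∀
  scaled : (4 + 5 * i + i * i) * ((3 + i) * q ^ n) ≤ (4 + 5 * i + i * i) * (suc i * (q + 2) ^ n)
  scaled = begin
    (4 + 5 * i + i * i) * ((3 + i) * q ^ n)     ≡⟨ swap (4 + 5 * i + i * i) (3 + i) (q ^ n) ⟩
    (3 + i) * (q ^ n * (4 + 5 * i + i * i))     ≡⟨ cong (λ s → (3 + i) * (q ^ n * s)) (slope-eq i) ⟨
    (3 + i) * (q ^ n * (q + n * 2))             ≤⟨ *-monoʳ-≤ (3 + i) (bernoulli q 2 n) ⟩
    (3 + i) * (q * (q + 2) ^ n)                 ≡⟨ *-assoc (3 + i) q ((q + 2) ^ n) ⟨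
    (3 + i) * q * (q + 2) ^ n                   ≤⟨ *-monoˡ-≤ ((q + 2) ^ n) (m≤m+n ((3 + i) * q) 4) ⟩
    ((3 + i) * q + 4) * (q + 2) ^ n             ≡⟨ cong (_* (q + 2) ^ n) (expand i) ⟩
    (4 + 5 * i + i * i) * suc i * (q + 2) ^ n   ≡⟨ *-assoc (4 + 5 * i + i * i) (suc i) ((q + 2) ^ n) ⟩
    (4 + 5 * i + i * i) * (suc i * (q + 2) ^ n) ∎

ratio-≥ : ∀ {P Q j₀ j} → 1 ≤ j₀ → P * j₀ ^ j₀ ≤ Q * (2 + j₀) ^ j₀ → j₀ ≤′ j → P * j ^ j ≤ Q * (2 + j) ^ j
ratio-≥ 1≤j₀ base ≤′-refl = base
ratio-≥ {P} {Q} {j₀} {suc j} 1≤j₀ base (≤′-step j₀≤j) = *-cancelˡ-≤′ (1≤^ j (≤-trans 1≤j₀ (≤′⇒≤ j₀≤j))) (begin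
  j ^ j * (P * suc j ^ suc j)               ≡⟨ regroup (j ^ j) P (suc j ^ suc j) ⟩
  P * j ^ j * suc j ^ suc j                 ≤⟨ *-monoˡ-≤ (suc j ^ suc j) (ratio-≥ {P} {Q} 1≤j₀ base j₀≤j) ⟩
  Q * (2 + j) ^ j * suc j ^ suc j           ≡⟨ *-assoc Q ((2 + j) ^ j) (suc j ^ suc j) ⟩
  Q * ((2 + j) ^ j * suc j ^ suc j)         ≤⟨ *-monoʳ-≤ Q (ratio-increasing j) ⟩
  Q * ((3 + j) ^ suc j * j ^ j)             ≡⟨ regroup′ Q ((3 + j) ^ suc j) (j ^ j) ⟩
  j ^ j * (Q * (3 + j) ^ suc j)             ∎)
  where
  open ≤-Reasoning
  regroup : ∀ x y z → x * (y * z) ≡ y * x * z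
  regroup = solve-∀
  regroup′ : ∀ x y z → x * (y * z) ≡ z * (x * y)
  regroup′ = solve-∀

ratio-≤ : ∀ {P Q i₀ i} → 1 ≤ i₀ → P * (2 + i₀) ^ (2 + i₀) ≤ Q * i₀ ^ (2 + i₀) → i₀ ≤′ i →
  P * (2 + i) ^ (2 + i) ≤ Q * i ^ (2 + i)
ratio-≤ 1≤i₀ base ≤′-refl = base
ratio-≤ {P} {Q} {i₀} {suc i} 1≤i₀ base (≤′-step i₀≤i) = *-cancelˡ-≤′ (1≤^ (2 + i) (≤-trans 1≤i₀ (≤′⇒≤ i₀≤i))) (begin
  i ^ (2 + i) * (P * (3 + i) ^ (3 + i))         ≡⟨ regroup (i ^ (2 + i)) P _ ⟩
  P * ((3 + i) ^ (3 + i) * i ^ (2 + i))         ≤⟨ *-monoʳ-≤ P (ratio-decreasing i) ⟩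
  P * (suc i ^ (3 + i) * (2 + i) ^ (2 + i))     ≡⟨ regroup′ P (suc i ^ (3 + i)) _ ⟩
  suc i ^ (3 + i) * (P * (2 + i) ^ (2 + i))     ≤⟨ *-monoʳ-≤ (suc i ^ (3 + i)) (ratio-≤ {P} {Q} 1≤i₀ base i₀≤i) ⟩
  suc i ^ (3 + i) * (Q * i ^ (2 + i))           ≡⟨ regroup (suc i ^ (3 + i)) Q _ ⟩
  Q * (i ^ (2 + i) * suc i ^ (3 + i))           ≡⟨ regroup′ Q (i ^ (2 + i)) _ ⟩
  i ^ (2 + i) * (Q * suc i ^ (3 + i))           ∎)
  where
  open ≤-Reasoning
  regroup : ∀ x y z → x * (y * z) ≡ y * (z * x)
  regroup = solve-∀
  regroup′ : ∀ x y z → x * (y * z) ≡ y * (x * z)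
  regroup′ = solve-∀

combine-ratios : ∀ {P Q P′ Q′ U V X Y} → 1 ≤ V → 1 ≤ Y →
  4 * (Q′ * (Q * Q)) < P′ * (P * P) → P * X ≤ Q * Y → P′ * U ≤ Q′ * V → 4 * (U * (X * X)) < V * (Y * Y)
combine-ratios {P} {Q} {P′} {Q′} {U} {V} {X} {Y} 1≤V 1≤Y consts PX≤QY P′U≤Q′V =
  *-cancelˡ-<′ (P′ * (P * P)) (begin-strict
    P′ * (P * P) * (4 * (U * (X * X)))      ≡⟨ regroup P P′ U X ⟩
    4 * (P′ * U * (P * X * (P * X)))        ≤⟨ *-monoʳ-≤ 4 (*-mono-≤ P′U≤Q′V (*-mono-≤ PX≤QY PX≤QY)) ⟩
    4 * (Q′ * V * (Q * Y * (Q * Y)))        ≡⟨ regroup′ Q Q′ V Y ⟩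
    4 * (Q′ * (Q * Q)) * (V * (Y * Y))      <⟨ *-monoˡ-< (V * (Y * Y)) {{>-nonZero (*-mono-≤ 1≤V (*-mono-≤ 1≤Y 1≤Y))}} consts ⟩
    P′ * (P * P) * (V * (Y * Y))            ∎)
  where
  open ≤-Reasoning
  regroup : ∀ P P′ U X → P′ * (P * P) * (4 * (U * (X * X))) ≡ 4 * (P′ * U * (P * X * (P * X)))
  regroup = solve-∀
  regroup′ : ∀ Q Q′ V Y → 4 * (Q′ * V * (Q * Y * (Q * Y))) ≡ 4 * (Q′ * (Q * Q)) * (V * (Y * Y))
  regroup′ = solve-∀

key-ratio : ∀ j → 6 ≤ j → let J = j * (2 + j) in
  4 * ((2 + J) ^ (2 + J) * (j ^ j * j ^ j)) < J ^ (2 + J) * ((2 + j) ^ j * (2 + j) ^ j)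
key-ratio j 6≤j = combine-ratios {4 ^ 6} {3 ^ 6} {24 ^ 50} {25 ^ 50}
  {(2 + J) ^ (2 + J)} {J ^ (2 + J)} {j ^ j} {(2 + j) ^ j}
  (1≤^ (2 + J) (≤-trans (s≤s z≤n) 48≤J)) (1≤^ j (s≤s z≤n))
  (<ᵇ⇒< (4 * (25 ^ 50 * (3 ^ 6 * 3 ^ 6))) (24 ^ 50 * (4 ^ 6 * 4 ^ 6)) tt)
  (ratio-≥ {4 ^ 6} {3 ^ 6} {6} {j} (s≤s z≤n) (≤ᵇ⇒≤ (4 ^ 6 * 6 ^ 6) (3 ^ 6 * 8 ^ 6) tt) (≤⇒≤′ 6≤j))
  (ratio-≤ {24 ^ 50} {25 ^ 50} {48} {J} (s≤s z≤n) (≤ᵇ⇒≤ (24 ^ 50 * 50 ^ 50) (25 ^ 50 * 48 ^ 50) tt) (≤⇒≤′ 48≤J))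
  where
  J = j * (2 + j)
  48≤J : 48 ≤ J
  48≤J = *-mono-≤ 6≤j (+-monoʳ-≤ 2 6≤j)

∃-isqrt : ∀ x → ∃[ j ] j * j ≤ x × x < suc j * suc j
∃-isqrt zero = 0 , z≤n , s≤s z≤n
∃-isqrt (suc x) with ∃-isqrt x
... | j , lo , hi with suc j * suc j ≤? suc x
...   | yes next = suc j , next , ≤-trans (s≤s hi) (*-mono-< (n<1+n (suc j)) (n<1+n (suc j)))
...   | no ¬next = j , m≤n⇒m≤1+n lo , ≰⇒> ¬next

-- With j = ⌊√(2k − 2)⌋ take a / b = j and c : d = j² : (j + 2)².
large-parameters : ∀ k → 19 ≤ k → Parameters k
large-parameters k 19≤k = record
  { a = j
  ; b = 1
  ; c = j * j
  ; d = (2 + j) * (2 + j)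
  ; e = e
  ; e+a≡kb = trans (m∸n+n≡m j≤k) (sym (*-identityʳ k))
  ; b>0 = ≤-refl
  ; c>0 = *-mono-≤ 1≤j 1≤j
  ; c≤d = *-mono-≤ (m≤n+m j 2) (m≤n+m j 2)
  ; slope = ≤-trans (≤-reflexive (+-comm (suc (j * j)) 1))
      (≤-trans (s≤s (s≤s j²≤x)) (≤-reflexive (trans (sym 2k≡) (sym (*-identityʳ (2 * k))))))
  ; decay = subst (λ z → 4 ^ 1 * (j * j + (2 + j) * (2 + j)) ^ (2 * z)
        < 4 ^ z * ((j * j) ^ e * ((2 + j) * (2 + j)) ^ (z + j))) (sym (*-identityʳ k)) decay
  }
  where
  open ≤-Reasoning
  x = 2 * k ∸ 2
  2k≡ : 2 * k ≡ 2 + x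
  2k≡ = sym (m+[n∸m]≡n (≤-trans (s≤s (s≤s z≤n)) (*-monoʳ-≤ 2 19≤k)))
  j = proj₁ (∃-isqrt x)
  j²≤x : j * j ≤ x
  j²≤x = proj₁ (proj₂ (∃-isqrt x))
  6≤j : 6 ≤ j
  6≤j = ≮⇒≥ λ j<6 → <⇒≱ (proj₂ (proj₂ (∃-isqrt x)))
    (≤-trans (*-mono-≤ j<6 j<6) (∸-monoˡ-≤ 2 (*-monoʳ-≤ 2 19≤k)))
  1≤j = ≤-trans (s≤s z≤n) 6≤j
  j≤k : j ≤ k
  j≤k = *-cancelˡ-≤ 2 (≤-trans (*-monoˡ-≤ j (≤-trans (s≤s (s≤s z≤n)) 6≤j)) (≤-trans j²≤x (m∸n≤m (2 * k) 2)))
  e = k ∸ j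
  J = j * (2 + j)
  x≤J : x ≤ J
  x≤J = s≤s⁻¹ (≤-trans (proj₂ (proj₂ (∃-isqrt x))) (≤-reflexive (square j)))
    where
    square : ∀ j → suc j * suc j ≡ suc (j * (2 + j))
    square = solve-∀
  f = J ∸ x
  2+J≡ : 2 + J ≡ 2 * k + f
  2+J≡ = trans (cong (2 +_) (sym (m+[n∸m]≡n x≤J))) (cong (_+ f) (sym 2k≡))
  X = j ^ j * j ^ j
  Y = (2 + j) ^ j * (2 + j) ^ j
  -- The exponent 2 + J of `key-ratio` may exceed 2k. The f surplus factors are 2 + J on the left
  -- and J on the right, so dropping them preserves the inequality.
  reduced : 4 * ((2 + J) ^ (2 * k) * X) < J ^ (2 * k) * Y
  reduced = *-cancelˡ-<′ (J ^ f) (begin-strict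
    J ^ f * (4 * ((2 + J) ^ (2 * k) * X))         ≤⟨ *-monoˡ-≤ (4 * ((2 + J) ^ (2 * k) * X)) (^-monoˡ-≤ f (m≤n+m J 2)) ⟩
    (2 + J) ^ f * (4 * ((2 + J) ^ (2 * k) * X))   ≡⟨ regroup ((2 + J) ^ f) ((2 + J) ^ (2 * k)) X ⟩
    4 * ((2 + J) ^ (2 * k) * (2 + J) ^ f * X)     ≡⟨ cong (λ z → 4 * (z * X)) (trans (sym (^-distribˡ-+-* (2 + J) (2 * k) f)) (cong ((2 + J) ^_) (sym 2+J≡))) ⟩
    4 * ((2 + J) ^ (2 + J) * X)                   <⟨ key-ratio j 6≤j ⟩
    J ^ (2 + J) * Y                               ≡⟨ cong (_* Y) (trans (cong (J ^_) 2+J≡) (^-distribˡ-+-* J (2 * k) f)) ⟩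
    J ^ (2 * k) * J ^ f * Y                       ≡⟨ regroup′ (J ^ (2 * k)) (J ^ f) Y ⟩
    J ^ f * (J ^ (2 * k) * Y)                     ∎)
    where
    regroup : ∀ u v w → u * (4 * (v * w)) ≡ 4 * (v * u * w)
    regroup = solve-∀
    regroup′ : ∀ u v w → u * v * w ≡ v * (u * w)
    regroup′ = solve-∀
  c = j * j
  d = (2 + j) * (2 + j)
  -- The squares are chosen for these two identities: c + d = 2 (2 + J) and c d = J², while (d /
  -- c)^j = ((2 + j) / j)^(2 j). They turn `decay` into `reduced`.
  c+d≡ : ∀ j → j * j + (2 + j) * (2 + j) ≡ 2 * (2 + j * (2 + j))
  c+d≡ = solve-∀
  cd≡ : ∀ j → j * j * ((2 + j) * (2 + j)) ≡ j * (2 + j) * (j * (2 + j))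
  cd≡ = solve-∀
  decay : 4 ^ 1 * (c + d) ^ (2 * k) < 4 ^ k * (c ^ e * d ^ (k + j))
  decay = *-cancelˡ-<′ (c ^ j) (begin-strict
    c ^ j * (4 ^ 1 * (c + d) ^ (2 * k))
      ≡⟨ cong₂ (λ u v → u * (4 ^ 1 * v)) (^-distribʳ-* j j j)
           (trans (cong (_^ (2 * k)) (c+d≡ j)) (trans (^-distribʳ-* 2 (2 + J) (2 * k)) (cong (_* (2 + J) ^ (2 * k)) (sym (^-*-assoc 2 2 k))))) ⟩
    X * (4 ^ 1 * (4 ^ k * (2 + J) ^ (2 * k)))
      ≡⟨ regroup X (4 ^ k) ((2 + J) ^ (2 * k)) ⟩
    4 ^ k * (4 * ((2 + J) ^ (2 * k) * X))
      <⟨ *-monoʳ-< (4 ^ k) {{>-nonZero (1≤^ k (s≤s {n = 3} z≤n))}} reduced ⟩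
    4 ^ k * (J ^ (2 * k) * Y)
      ≡⟨ cong (4 ^ k *_) (cong₂ _*_ (trans (sym (^-*-assoc J 2 k)) (trans (cong (_^ k) (trans (cong (J *_) (*-identityʳ J)) (sym (cd≡ j)))) (^-distribʳ-* c d k))) (sym (^-distribʳ-* (2 + j) (2 + j) j))) ⟩
    4 ^ k * (c ^ k * d ^ k * d ^ j)
      ≡⟨ cong (λ z → 4 ^ k * (z * d ^ k * d ^ j)) (trans (cong (c ^_) (sym (m∸n+n≡m j≤k))) (^-distribˡ-+-* c e j)) ⟩
    4 ^ k * (c ^ e * c ^ j * d ^ k * d ^ j)
      ≡⟨ regroup′ (4 ^ k) (c ^ e) (c ^ j) (d ^ k) (d ^ j) ⟩
    c ^ j * (4 ^ k * (c ^ e * (d ^ k * d ^ j)))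
      ≡⟨ cong (λ z → c ^ j * (4 ^ k * (c ^ e * z))) (^-distribˡ-+-* d k j) ⟨
    c ^ j * (4 ^ k * (c ^ e * d ^ (k + j)))   ∎)
    where
    regroup : ∀ x p y → x * (4 * (p * y)) ≡ p * (4 * (y * x))
    regroup = solve-∀
    regroup′ : ∀ p u v w z → p * (u * v * w * z) ≡ v * (p * (u * (w * z)))
    regroup′ = solve-∀

-- The conditions are Boolean tests, so each row of the table is verified by evaluation.
small-parameters : ∀ k a b c d e → e + a ≡ k * b →
  T (1 ≤ᵇ b) → T (1 ≤ᵇ c) → T (c ≤ᵇ d) → T (suc (a * a) + b * b ≤ᵇ 2 * k * (b * b)) →
  T (4 ^ b * (c + d) ^ (2 * (k * b)) <ᵇ 4 ^ (k * b) * (c ^ e * d ^ (k * b + a))) → Parameters k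
small-parameters k a b c d e sum-eq b>0 c>0 c≤d slope decay = record
  { a = a ; b = b ; c = c ; d = d ; e = e
  ; e+a≡kb = sum-eq
  ; b>0 = ≤ᵇ⇒≤ 1 b b>0
  ; c>0 = ≤ᵇ⇒≤ 1 c c>0
  ; c≤d = ≤ᵇ⇒≤ c d c≤d
  ; slope = ≤ᵇ⇒≤ _ _ slope
  ; decay = <ᵇ⇒< _ _ decay
  }

-- In every row a / b is a simple fraction below √(2k - 1), and c : d is (k b - a) : (k b + a) in
-- lowest terms, the ratio of arcs inside and outside the critical cut, which is optimal in the
-- exponential Markov inequality. From k = 19 on, 2k - 2 ≥ 6², as `key-ratio` requires.
parameters : ∀ l → 1 ≤ l → Parameters (suc (2 * l))
parameters 1 _ = small-parameters 3 2 1 1 5 1 refl tt tt tt tt tt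
parameters 2 _ = small-parameters 5 8 3 7 23 7 refl tt tt tt tt tt
parameters 3 _ = small-parameters 7 7 2 1 3 7 refl tt tt tt tt tt
parameters 4 _ = small-parameters 9 4 1 5 13 5 refl tt tt tt tt tt
parameters 5 _ = small-parameters 11 4 1 7 15 7 refl tt tt tt tt tt
parameters 6 _ = small-parameters 13 9 2 17 35 17 refl tt tt tt tt tt
parameters 7 _ = small-parameters 15 5 1 1 2 10 refl tt tt tt tt tt
parameters 8 _ = small-parameters 17 5 1 6 11 12 refl tt tt tt tt tt
parameters l@(suc (suc (suc (suc (suc (suc (suc (suc (suc i))))))))) _ =
  large-parameters (suc (2 * l)) (s≤s (*-monoʳ-≤ 2 (m≤m+n 9 i)))

-- Digraphs without sparse balanced cuts

arcTotal≡ : ∀ k b n → k * (2 * (b * n)) ≡ 2 * (k * b) * n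
arcTotal≡ = solve-∀

-- Removes the factorials: `central-binomial` trades the orderings on the two sides for all
-- matchings, and `falling-factorial` trades these for the greedy product. Both cost only the factor
-- `suc τ * τ ^ K`.
first-moment : ∀ k g h c d w → let K = k * maxObstruction g k; τ = k * (2 * h) in K ≤ τ →
  (τ ∸ K) ! * w ≤ 2 ^ (2 * h) * ((c + d) ^ τ * ((k * h) ! * (k * h) !)) →
  4 ^ (k * h) * w ≤ suc τ * τ ^ K * (4 ^ h * (c + d) ^ τ)
first-moment k g h c d w K≤τ moment = *-cancelˡ-≤′ (*-mono-≤ (1≤n! m) (1≤n! m)) (begin
  m ! * m ! * (4 ^ m * w)                       ≡⟨ regroup (m ! * m !) (4 ^ m) w ⟩
  4 ^ m * (m ! * m !) * w                       ≤⟨ *-monoˡ-≤ w (central-binomial m) ⟩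
  suc (2 * m) * (2 * m) ! * w                   ≡⟨ cong (λ t → suc t * t ! * w) (sym τ≡) ⟩
  suc τ * τ ! * w                               ≤⟨ *-monoˡ-≤ w (*-monoʳ-≤ (suc τ) τ!≤) ⟩
  suc τ * (τ ^ K * (τ ∸ K) !) * w               ≡⟨ regroup′ (suc τ) (τ ^ K) ((τ ∸ K) !) w ⟩
  suc τ * τ ^ K * ((τ ∸ K) ! * w)               ≤⟨ *-monoʳ-≤ (suc τ * τ ^ K) moment ⟩
  suc τ * τ ^ K * (2 ^ (2 * h) * ((c + d) ^ τ * (m ! * m !)))
    ≡⟨ cong (λ z → suc τ * τ ^ K * (z * ((c + d) ^ τ * (m ! * m !)))) (sym (^-*-assoc 2 2 h)) ⟩
  suc τ * τ ^ K * (4 ^ h * ((c + d) ^ τ * (m ! * m !)))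
    ≡⟨ regroup″ (suc τ * τ ^ K) (4 ^ h) ((c + d) ^ τ) (m ! * m !) ⟩
  m ! * m ! * (suc τ * τ ^ K * (4 ^ h * (c + d) ^ τ)) ∎)
  where
  open ≤-Reasoning
  m = k * h
  K = k * maxObstruction g k
  τ = k * (2 * h)
  τ≡ : τ ≡ 2 * m
  τ≡ = swap k h
    where
    swap : ∀ k h → k * (2 * h) ≡ 2 * (k * h)
    swap = solve-∀
  τ!≤ : τ ! ≤ τ ^ K * (τ ∸ K) !
  τ!≤ = subst (λ t → t ! ≤ t ^ K * (τ ∸ K) !) (m+[n∸m]≡n K≤τ) (falling-factorial K (τ ∸ K))
  regroup : ∀ x y z → x * (y * z) ≡ y * x * z
  regroup = solve-∀
  regroup′ : ∀ x y z w → x * (y * z) * w ≡ x * y * (z * w)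
  regroup′ = solve-∀
  regroup″ : ∀ x y z w → x * (y * (z * w)) ≡ w * (x * (y * z))
  regroup″ = solve-∀

-- As c ≤ d, a sparser cut weighs more; hence the estimate at the critical size `e * n` rules out
-- every smaller cut as well.
weight-antitone : ∀ {c d x X τ} → c ≤ d → x ≤ X → X ≤ τ → c ^ X * d ^ (τ ∸ X) ≤ c ^ x * d ^ (τ ∸ x)
weight-antitone {c} {d} {x} c≤d x≤X X≤τ with m≤n⇒∃[o]m+o≡n x≤X | m≤n⇒∃[o]m+o≡n X≤τ
... | i , refl | j , refl = begin
  c ^ (x + i) * d ^ (x + i + j ∸ (x + i))   ≡⟨ cong₂ (λ y z → y * d ^ z) (^-distribˡ-+-* c x i) (m+n∸m≡n (x + i) j) ⟩
  c ^ x * c ^ i * d ^ j                     ≤⟨ *-monoˡ-≤ (d ^ j) (*-monoʳ-≤ (c ^ x) (^-monoˡ-≤ i c≤d)) ⟩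
  c ^ x * d ^ i * d ^ j                     ≡⟨ trans (*-assoc (c ^ x) _ _) (cong (c ^ x *_) (sym (^-distribˡ-+-* d i j))) ⟩
  c ^ x * d ^ (i + j)                       ≡⟨ cong (λ z → c ^ x * d ^ z) (trans (cong (_∸ x) (+-assoc x i j)) (m+n∸m≡n x (i + j))) ⟨
  c ^ x * d ^ (x + i + j ∸ x)               ∎
  where open ≤-Reasoning

module _ {k} (ps : Parameters k) where
  open Parameters ps

  sparse-cuts-impossible : ∀ g n w → let K = k * maxObstruction g k; h = b * n; τ = k * (2 * h) in
    1 ≤ k → 1 ≤ n → K ≤ τ → c ^ (e * n) * d ^ (τ ∸ e * n) ≤ w →
    (3 * (k * b) * n) ^ suc K * (4 ^ b * (c + d) ^ (2 * (k * b))) ^ n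
      < (4 ^ (k * b) * (c ^ e * d ^ (k * b + a))) ^ n →
    ¬ ((τ ∸ K) ! * w ≤ 2 ^ (2 * h) * ((c + d) ^ τ * ((k * h) ! * (k * h) !)))
  sparse-cuts-impossible g n w 1≤k 1≤n K≤τ w≥ large moment = <⇒≱ large (begin
    (4 ^ (k * b) * (c ^ e * d ^ (k * b + a))) ^ n
      ≡⟨ trans (^-distribʳ-* (4 ^ (k * b)) _ n) (cong₂ _*_ 4-power (trans (^-distribʳ-* (c ^ e) _ n) (cong₂ _*_ (^-*-assoc c e n) d-power))) ⟩
    4 ^ (k * h) * (c ^ (e * n) * d ^ (τ ∸ e * n))        ≤⟨ *-monoʳ-≤ (4 ^ (k * h)) w≥ ⟩
    4 ^ (k * h) * w                                      ≤⟨ first-moment k g h c d w K≤τ moment ⟩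
    suc τ * τ ^ K * (4 ^ h * (c + d) ^ τ)                ≤⟨ *-monoˡ-≤ (4 ^ h * (c + d) ^ τ) (*-mono-≤ τ<Cn (^-monoˡ-≤ K (<⇒≤ τ<Cn))) ⟩
    (3 * (k * b) * n) ^ suc K * (4 ^ h * (c + d) ^ τ)
      ≡⟨ cong ((3 * (k * b) * n) ^ suc K *_) (cong₂ _*_ (^-*-assoc 4 b n) (trans (^-*-assoc (c + d) (2 * (k * b)) n) (cong ((c + d) ^_) (sym (arcTotal≡ k b n))))) ⟨
    (3 * (k * b) * n) ^ suc K * ((4 ^ b) ^ n * ((c + d) ^ (2 * (k * b))) ^ n)
      ≡⟨ cong ((3 * (k * b) * n) ^ suc K *_) (^-distribʳ-* (4 ^ b) _ n) ⟨
    (3 * (k * b) * n) ^ suc K * (4 ^ b * (c + d) ^ (2 * (k * b))) ^ n ∎)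
    where
    open ≤-Reasoning
    K = k * maxObstruction g k
    h = b * n
    τ = k * (2 * h)
    4-power : (4 ^ (k * b)) ^ n ≡ 4 ^ (k * h)
    4-power = trans (^-*-assoc 4 (k * b) n) (cong (4 ^_) (*-assoc k b n))
    τ≡ : τ ≡ e * n + (k * b + a) * n
    τ≡ = trans (arcTotal≡ k b n) (trans (double (k * b) n) (trans (cong (λ z → (k * b + z) * n) (sym e+a≡kb)) (regroup (k * b) e a n)))
      where
      double : ∀ x n → 2 * x * n ≡ (x + x) * n
      double = solve-∀
      regroup : ∀ x e a n → (x + (e + a)) * n ≡ e * n + (x + a) * n
      regroup = solve-∀
    d-power : (d ^ (k * b + a)) ^ n ≡ d ^ (τ ∸ e * n)
    d-power = trans (^-*-assoc d (k * b + a) n)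
      (cong (d ^_) (sym (trans (cong (_∸ e * n) τ≡) (m+n∸m≡n (e * n) ((k * b + a) * n)))))
    τ<Cn : τ < 3 * (k * b) * n
    τ<Cn = begin
      suc τ                              ≡⟨ cong suc (arcTotal≡ k b n) ⟩
      suc (2 * (k * b) * n)              ≤⟨ +-monoˡ-≤ (2 * (k * b) * n) (*-mono-≤ (*-mono-≤ 1≤k b>0) 1≤n) ⟩
      k * b * n + 2 * (k * b) * n        ≡⟨ triple (k * b) n ⟩
      3 * (k * b) * n                    ∎
      where
      triple : ∀ x n → x * n + 2 * x * n ≡ 3 * x * n
      triple = solve-∀

  expander : ∀ g N → 1 ≤ k → ∃[ n ] N ≤ n × 1 ≤ n × ∃[ A ]
    Partial {2 * (b * n)} g k A × arcCount A + k * maxObstruction g k ≡ k * (2 * (b * n)) ×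
    (∀ S → count S ≡ b * n → e * n ≤ cut S A)
  expander g N 1≤k = n , ≤-trans (m≤m+n N (suc M)) N′≤n , 1≤n , A , proj₁ (proj₂ run) , proj₁ (proj₂ (proj₂ run)) ,
    λ S half → ≮⇒≥ λ sparse → sparse-cuts-impossible g n _ 1≤k 1≤n K≤τ
      (weight-antitone c≤d (<⇒≤ sparse) X≤τ) (proj₂ (proj₂ n-large)) (proj₂ (proj₂ (proj₂ run)) S half)
    where
    M = maxObstruction g k
    1≤α : 1 ≤ 4 ^ b * (c + d) ^ (2 * (k * b))
    1≤α = *-mono-≤ (1≤^ b (s≤s z≤n)) (1≤^ (2 * (k * b)) (≤-trans c>0 (m≤m+n c d)))
    -- The summand `suc M` forces M < n, so that the `k * M` arcs to be left out do not exceed the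
    -- total.
    n-large = exponential-beats-polynomial (3 * (k * b)) (suc (k * M)) (N + suc M) 1≤α decay
    n : ℕ
    n = proj₁ n-large
    N′≤n : N + suc M ≤ n
    N′≤n = proj₁ (proj₂ n-large)
    M<n : M < n
    M<n = ≤-trans (m≤n+m (suc M) N) N′≤n
    1≤n : 1 ≤ n
    1≤n = ≤-trans (s≤s z≤n) M<n
    K≤τ : k * M ≤ k * (2 * (b * n))
    K≤τ = *-monoʳ-≤ k (≤-trans (<⇒≤ M<n) (≤-trans (m≤n*m n b {{>-nonZero b>0}}) (m≤n*m (b * n) 2)))
    X≤τ : e * n ≤ k * (2 * (b * n))
    X≤τ = ≤-trans (*-monoˡ-≤ n (≤-trans (m≤m+n e a) (≤-trans (≤-reflexive e+a≡kb) (m≤n*m (k * b) 2)))) (≤-reflexive (sym (arcTotal≡ k b n)))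
    run = Potential.greedy k c d g (b * n) K≤τ
    A : Digraph (2 * (b * n))
    A = proj₁ run

  expander-fas : ∀ g n (A : Digraph (2 * (b * n))) → Partial g k A →
    arcCount A + k * maxObstruction g k ≡ k * (2 * (b * n)) →
    (∀ S → count S ≡ b * n → e * n ≤ cut S A) → TwiceFasAtLeast (e * n ∸ k * maxObstruction g k) A
  expander-fas g n A P deficit dense F (F⊆A , acyclic)
    with ∃-outClosed (A minus F) acyclic (b * n) (m≤n*m (b * n) 2)
  ... | S , half , closed = m≤n+o⇒m∸n≤o (e * n) (k * maxObstruction g k) (≤-trans (dense S half)
    (≤-trans (cut≤ A F P deficit S closed) (≤-reflexive (+-comm (2 * arcCount F) _))))

  -- Since a² < q b², the additive error C is absorbed once N is large.
  absorb-error : ∀ {q} N N′ C Z → suc q ≡ 2 * k → 1 ≤ N → N ≤ N′ → 2 * a * (b * C) + b * C * (b * C) ≤ N →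
    b * Z ≤ a * N + b * C → Z * Z ≤ q * (N′ * N′)
  absorb-error {q} N N′ C Z q≡ 1≤N N≤N′ large bZ≤ = *-cancelˡ-≤′ (*-mono-≤ b>0 b>0) (begin
    b * b * (Z * Z)                                          ≡⟨ square b Z ⟩
    b * Z * (b * Z)                                          ≤⟨ *-mono-≤ bZ≤ bZ≤ ⟩
    (a * N + b * C) * (a * N + b * C)                        ≡⟨ binomial a N (b * C) ⟩
    a * a * (N * N) + (2 * a * (b * C) * N + b * C * (b * C))
      ≤⟨ +-monoʳ-≤ (a * a * (N * N)) (+-monoʳ-≤ (2 * a * (b * C) * N) (m≤m*n (b * C * (b * C)) N {{>-nonZero 1≤N}})) ⟩
    a * a * (N * N) + (2 * a * (b * C) * N + b * C * (b * C) * N)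
      ≡⟨ cong (a * a * (N * N) +_) (sym (*-distribʳ-+ N (2 * a * (b * C)) _)) ⟩
    a * a * (N * N) + (2 * a * (b * C) + b * C * (b * C)) * N ≤⟨ +-monoʳ-≤ (a * a * (N * N)) (*-monoˡ-≤ N large) ⟩
    a * a * (N * N) + N * N                                  ≡⟨ +-comm _ (N * N) ⟩
    suc (a * a) * (N * N)                                    ≤⟨ *-mono-≤ a²<qb² (*-mono-≤ N≤N′ N≤N′) ⟩
    q * (b * b) * (N′ * N′)                                  ≡⟨ regroup q (b * b) (N′ * N′) ⟩
    b * b * (q * (N′ * N′))                                  ∎)
    where
    open ≤-Reasoning
    square : ∀ b z → b * b * (z * z) ≡ b * z * (b * z)
    square = solve-∀
    binomial : ∀ a n c → (a * n + c) * (a * n + c) ≡ a * a * (n * n) + (2 * a * c * n + c * c)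
    binomial = solve-∀
    regroup : ∀ x y z → x * y * z ≡ y * (x * z)
    regroup = solve-∀
    a²<qb² : suc (a * a) ≤ q * (b * b)
    a²<qb² = +-cancelʳ-≤ (b * b) _ _ (≤-trans slope (≤-reflexive (trans (cong (_* (b * b)) (sym q≡)) (+-comm (b * b) _))))

  -- After division by 2k the claim is Z ≤ √q N′ for Z = k N′ - 4 f. From 2 f ≥ e n - K and e = k b
  -- - a follows b Z ≤ a N + b C, where C = 2 K + k L collects the errors due to the missing arcs
  -- and to the added vertices; `absorb-error` finishes.
  fasLowerBound : ∀ {q n K L} (D : Digraph (2 * (b * n) + L)) → Regular k D → suc q ≡ 2 * k → 1 ≤ n →
    2 * a * (b * (2 * K + k * L)) + b * (2 * K + k * L) * (b * (2 * K + k * L)) ≤ n →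
    TwiceFasAtLeast (e * n ∸ K) D → FasLowerBound q D
  fasLowerBound {q} {n} {K} {L} D regular q≡ 1≤n large lower F isFAS =
    -- The second alternative always serves: where the first holds, the truncated difference is 0.
    inj₂ (subst (λ A → (suc q * A ∸ 4 * suc q * f) * (suc q * A ∸ 4 * suc q * f) ≤ 4 * q * (A * A)) (sym arcs) (begin
      (suc q * (k * N′) ∸ 4 * suc q * f) * (suc q * (k * N′) ∸ 4 * suc q * f)
        ≡⟨ cong (λ x → x * x) difference ⟩
      2 * k * Z * (2 * k * Z)           ≡⟨ square k Z ⟩
      4 * (k * k) * (Z * Z)             ≤⟨ *-monoʳ-≤ (4 * (k * k)) (absorb-error N N′ C Z q≡
        (≤-trans 1≤n n≤N) (m≤m+n N L) (≤-trans large n≤N) bZ≤) ⟩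
      4 * (k * k) * (q * (N′ * N′))     ≡⟨ regroup k q N′ ⟩
      4 * q * (k * N′ * (k * N′))       ∎))
    where
    open ≤-Reasoning
    f = arcCount F
    N = 2 * (b * n)
    N′ = N + L
    C = 2 * K + k * L
    Z = k * N′ ∸ 4 * f
    n≤N : n ≤ N
    n≤N = ≤-trans (m≤n*m n b {{>-nonZero b>0}}) (m≤n*m (b * n) 2)
    arcs : arcCount D ≡ k * N′
    arcs = trans (sum-cong (proj₁ ∘ regular)) (trans (sum-const N′ k) (*-comm N′ k))
    difference : suc q * (k * N′) ∸ 4 * suc q * f ≡ 2 * k * Z
    difference = trans (cong (λ s → s * (k * N′) ∸ 4 * s * f) q≡)
      (trans (cong (2 * k * (k * N′) ∸_) (swap (2 * k) f)) (sym (*-distribˡ-∸ (2 * k) (k * N′) (4 * f))))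
      where
      swap : ∀ s f → 4 * s * f ≡ s * (4 * f)
      swap = solve-∀
    square : ∀ k z → 2 * k * z * (2 * k * z) ≡ 4 * (k * k) * (z * z)
    square = solve-∀
    regroup : ∀ k q n → 4 * (k * k) * (q * (n * n)) ≡ 4 * q * (k * n * (k * n))
    regroup = solve-∀
    en≤ : e * n ≤ K + 2 * f
    en≤ = ≤-trans (m≤n+m∸n (e * n) K) (+-monoʳ-≤ K (lower F isFAS))
    bZ≤ : b * Z ≤ a * N + b * C
    bZ≤ = begin
      b * Z                             ≡⟨ *-distribˡ-∸ b (k * N′) (4 * f) ⟩
      b * (k * N′) ∸ b * (4 * f)        ≤⟨ m≤n+o⇒m∸n≤o (b * (k * N′)) (b * (4 * f)) (begin
        b * (k * N′)                                          ≡⟨ expand b k n L ⟩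
        k * b * (2 * (b * n)) + b * (k * L)                   ≡⟨ cong (λ x → x * (2 * (b * n)) + b * (k * L)) e+a≡kb ⟨
        (e + a) * (2 * (b * n)) + b * (k * L)                 ≡⟨ collect e a b n (k * L) ⟩
        2 * b * (e * n) + (a * (2 * (b * n)) + b * (k * L))   ≤⟨ +-monoˡ-≤ _ (*-monoʳ-≤ (2 * b) en≤) ⟩
        2 * b * (K + 2 * f) + (a * (2 * (b * n)) + b * (k * L)) ≡⟨ finish b K f (a * (2 * (b * n))) (k * L) ⟩
        b * (4 * f) + (a * N + b * C)                         ∎) ⟩
      a * N + b * C                     ∎
      where
      expand : ∀ b k n L → b * (k * (2 * (b * n) + L)) ≡ k * b * (2 * (b * n)) + b * (k * L)
      expand = solve-∀
      collect : ∀ e a b n x → (e + a) * (2 * (b * n)) + b * x ≡ 2 * b * (e * n) + (a * (2 * (b * n)) + b * x)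
      collect = solve-∀
      finish : ∀ b K f y x → 2 * b * (K + 2 * f) + (y + b * x) ≡ b * (4 * f) + (y + b * (2 * K + x))
      finish = solve-∀

-- Partitions into feedback arc sets

arcCount-colourClasses : ∀ {n t} (A : Digraph n) (c : Fin n → Fin n → Fin t) →
  sumFin (λ j → arcCount (colourClass A c j)) ≡ arcCount A
arcCount-colourClasses {n} {t} A c = begin
  sumFin (λ j → sumFin (λ u → sumFin (λ v → 𝟙 (A u v ∧ ⌊ c u v ≟ j ⌋))))
    ≡⟨ sum-swap (λ j u → sumFin (λ v → 𝟙 (A u v ∧ ⌊ c u v ≟ j ⌋))) ⟩
  sumFin (λ u → sumFin (λ j → sumFin (λ v → 𝟙 (A u v ∧ ⌊ c u v ≟ j ⌋))))
    ≡⟨ sum-cong (λ u → trans (sum-swap (λ j v → 𝟙 (A u v ∧ ⌊ c u v ≟ j ⌋)))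
         (sum-cong (λ v → one-colour (A u v) (c u v)))) ⟩
  arcCount A ∎
  where
  open ≡-Reasoning
  one-colour : ∀ b i → sumFin {t} (λ j → 𝟙 (b ∧ ⌊ i ≟ j ⌋)) ≡ 𝟙 b
  one-colour true  i = trans (sum-cong (δ-sym i)) (sum-δ₁ i)
  one-colour false i = sum-zero t

-- The smallest of t classes has at most m / t arcs. Its lower bound, multiplied by t and divided by
-- m, is the claim; under the square this scaling is the comparison of truncated differences
-- `mX≤tY`.
fas⇒fasd : ∀ {n p} (A : Digraph n) → 1 ≤ arcCount A → FasLowerBound p A → FasdUpperBound p A
fas⇒fasd {p = p} A 1≤m lower zero    _ = inj₁ z≤n
fas⇒fasd {p = p} A 1≤m lower t@(suc _) (c , isFAS) = conclude (lower Fⱼ (isFAS j))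
  where
  open ≤-Reasoning
  m = arcCount A
  s = suc p
  class : Fin t → ℕ
  class j = arcCount (colourClass A c j)
  smallest = ∃-below-average (λ _ → 1) class (s≤s z≤n)
  j = proj₁ smallest
  Fⱼ = colourClass A c j
  f = class j
  tf≤m : t * f ≤ m
  tf≤m = begin
    t * f                             ≡⟨ cong (_* f) (trans (sum-const t 1) (*-identityʳ t)) ⟨
    sumFin {t} (λ _ → 1) * f          ≤⟨ proj₂ (proj₂ smallest) ⟩
    sumFin (λ i → 1 * class i)        ≡⟨ sum-cong (λ i → *-identityˡ (class i)) ⟩
    sumFin class                      ≡⟨ arcCount-colourClasses A c ⟩
    m                                 ∎
  4stf≤ : t * (4 * s * f) ≤ m * (4 * s)
  4stf≤ = ≤-trans (≤-reflexive (swap t (4 * s) f)) (≤-trans (*-monoʳ-≤ (4 * s) tf≤m) (≤-reflexive (*-comm (4 * s) m)))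
    where
    swap : ∀ x y z → x * (y * z) ≡ y * (x * z)
    swap = solve-∀
  tsm≡ : m * (t * s) ≡ t * (s * m)
  tsm≡ = rotate m t s
    where
    rotate : ∀ x y z → x * (y * z) ≡ y * (z * x)
    rotate = solve-∀
  conclude : LeWithSqrt (s * m) (4 * s * f) p m → LeWithSqrt (t * s) (4 * s) p t
  conclude (inj₁ small) = inj₁ (*-cancelˡ-≤′ 1≤m (≤-trans (≤-reflexive tsm≡) (≤-trans (*-monoʳ-≤ t small) 4stf≤)))
  conclude (inj₂ close) = inj₂ (*-cancelˡ-≤′ (*-mono-≤ 1≤m 1≤m) (begin
    m * m * (X * X)                   ≡⟨ square m X ⟩
    m * X * (m * X)                   ≤⟨ *-mono-≤ mX≤tY mX≤tY ⟩
    t * Y * (t * Y)                   ≡⟨ square t Y ⟨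
    t * t * (Y * Y)                   ≤⟨ *-monoʳ-≤ (t * t) close ⟩
    t * t * (4 * p * (m * m))         ≡⟨ exchange (t * t) (4 * p) (m * m) ⟩
    m * m * (4 * p * (t * t))         ∎))
    where
    X = t * s ∸ 4 * s
    Y = s * m ∸ 4 * s * f
    square : ∀ x y → x * x * (y * y) ≡ x * y * (x * y)
    square = solve-∀
    exchange : ∀ x y z → x * (y * z) ≡ z * (y * x)
    exchange = solve-∀
    mX≤tY : m * X ≤ t * Y
    mX≤tY = begin
      m * X                           ≡⟨ *-distribˡ-∸ m (t * s) (4 * s) ⟩
      m * (t * s) ∸ m * (4 * s)       ≤⟨ ∸-mono (≤-reflexive tsm≡) 4stf≤ ⟩
      t * (s * m) ∸ t * (4 * s * f)   ≡⟨ *-distribˡ-∸ t (s * m) (4 * s * f) ⟨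
      t * Y                           ∎

-- From the prime power to the degree

-- Together with p ≡ 1 modulo 4 this gives p ≥ 5, so the degree is at least 3, where `parameters`
-- begins.
oddPrimePower>1 : ∀ {q} → OddPrimePower q → q ≢ 1
oddPrimePower>1 (r , suc m , r-prime , _ , q≡ , _) q≡1 =
  <⇒≢ (nonTrivial⇒n>1 r {{prime⇒nonTrivial r-prime}}) (sym (m*n≡1⇒m≡1 r (r ^ m) (trans (sym q≡) q≡1)))

reindex : ∀ {N} {P : ∀ n → Digraph n → Set} → 1 ≤ N → ∃[ D ] P N D → Σ ℕ λ n → Σ (Digraph (suc n)) (P (suc n))
reindex {suc n} _ found = n , found

theorem6 : (g p : ℕ) → 3 ≤ g → OddPrimePower p → p % 4 ≡ 1 →
    Σ ℕ λ n → Σ (Digraph (suc n)) λ D →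
    Oriented D × Regular (suc p / 2) D × GirthAtLeast g D ×
    FasLowerBound p D × FasdUpperBound p D
theorem6 g@(suc g-1) p 3≤g power p%4≡1 =
  reindex {P = λ n D → Oriented D × Regular (suc p / 2) D × GirthAtLeast g D × FasLowerBound p D × FasdUpperBound p D}
    (≤-trans 1≤N (m≤m+n N _))
    (D , noShort⇒oriented 3≤g D-noShort , subst (λ k → Regular k D) (sym half≡k) D-regular ,
      noShort⇒girth D-noShort , D-fas , fas⇒fasd D 1≤arcs D-fas)
  where
  l = p / 4
  k = suc (2 * l)
  p≡ : p ≡ 1 + l * 4
  p≡ = trans (m≡m%n+[m/n]*n p 4) (cong (_+ l * 4) p%4≡1)
  1≤l : 1 ≤ l
  1≤l = n≢0⇒n>0 λ l≡0 → oddPrimePower>1 power (trans p≡ (cong (λ x → 1 + x * 4) l≡0))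
  q≡ : suc p ≡ 2 * k
  q≡ = trans (cong suc p≡) (double l)
    where
    double : ∀ l → 2 + l * 4 ≡ 2 * suc (2 * l)
    double = solve-∀
  half≡k : suc p / 2 ≡ k
  half≡k = trans (cong (_/ 2) (trans q≡ (*-comm 2 k))) (m*n/n≡m k 2)
  ps = parameters l 1≤l
  open Parameters ps using (a; b; b>0; e)
  K = k * maxObstruction g k
  -- One gadget with g k vertices for each of the K missing arcs.
  L = K * (g * k)
  C = 2 * K + k * L
  -- The errors K, L and C are determined by g and k, before n is chosen; so n can be taken as large
  -- as `fasLowerBound` demands.
  found = expander ps g (2 * a * (b * C) + b * C * (b * C)) (s≤s z≤n)
  n : ℕ
  n = proj₁ found
  large = proj₁ (proj₂ found)
  1≤n = proj₁ (proj₂ (proj₂ found))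
  A : Digraph (2 * (b * n))
  A = proj₁ (proj₂ (proj₂ (proj₂ found)))
  A-partial = proj₁ (proj₂ (proj₂ (proj₂ (proj₂ found))))
  A-deficit = proj₁ (proj₂ (proj₂ (proj₂ (proj₂ (proj₂ found)))))
  A-dense = proj₂ (proj₂ (proj₂ (proj₂ (proj₂ (proj₂ found)))))
  N = 2 * (b * n)
  1≤N : 1 ≤ N
  1≤N = *-mono-≤ {1} {2} (s≤s z≤n) (*-mono-≤ b>0 1≤n)
  completed = complete (gadget g-1 (2 * l)) K A A-partial A-deficit (expander-fas ps g n A A-partial A-deficit A-dense)
  D : Digraph (N + L)
  D = proj₁ completed
  D-regular : Regular k D
  D-regular = proj₁ (proj₂ completed)
  D-noShort : NoShortClosedWalk g D
  D-noShort = proj₁ (proj₂ (proj₂ completed))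
  D-fas : FasLowerBound p D
  D-fas = fasLowerBound ps {n = n} {K = K} D D-regular q≡ 1≤n large (proj₂ (proj₂ (proj₂ completed)))
  1≤arcs : 1 ≤ arcCount D
  1≤arcs = subst (1 ≤_) (sym (trans (sum-cong (proj₁ ∘ D-regular)) (sum-const (N + L) k)))
    (*-mono-≤ {1} {N + L} (≤-trans 1≤N (m≤m+n N L)) (s≤s z≤n))
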